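{- Let $m$ be a positive integer and let $n,x,y$ be rational integers satisfying $n\ge 3$, $\max\{|x|,|y|\}\ge 2$ and $\Phi_n(x,y)=m$. Then $$\varphi(n)\le \frac{2}{\log 3}\log m \quad\text{and}\quad \max\{|x|,|y|\}\le \frac{2}{\sqrt 3}\, m^{1/\varphi(n)}.$$
   Context: For $n\ge1$, $\phi_n(X)\in\mathbb Z[X]$ denotes the $n$-th cyclotomic polynomial, of degree $\varphi(n)$ (Euler's totient function). The cyclotomic binary form is $\Phi_n(X,Y)=Y^{\varphi(n)}\phi_n(X/Y)$, a homogeneous form of degree $\varphi(n)$ with integer coefficients. -}

module Defs where

open import Data.Nat as ℕ using (ℕ; zero; suc)
open import Data.Nat.Divisibility using (_∣?_)
open import Data.Nat.GCD using (gcd)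
open import Data.Integer as ℤ using (ℤ; +_)
open import Data.List using (List; []; _∷_; _++_; reverse; replicate; length)
open import Data.Bool using (if_then_else_)
open import Relation.Nullary.Decidable using (⌊_⌋)

totient : ℕ → ℕ
totient n = go n
  where
  go : ℕ → ℕ
  go zero    = 0
  go (suc k) = if ⌊ gcd (suc k) n ℕ.≟ 1 ⌋ then suc (go k) else go k

-- Integer polynomials as coefficient lists, LOW degree first.

Poly : Set
Poly = List ℤ

addP : Poly → Poly → Poly
addP []       q        = q
addP p        []       = p
addP (a ∷ p)  (b ∷ q)  = (a ℤ.+ b) ∷ addP p q

scaleP : ℤ → Poly → Poly
scaleP c []      = []
scaleP c (a ∷ p) = (c ℤ.* a) ∷ scaleP c p

mulP : Poly → Poly → Poly
mulP []      q = []
mulP (a ∷ p) q = addP (scaleP a q) (+ 0 ∷ mulP p q)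

oneP : Poly
oneP = + 1 ∷ []

xn-1 : ℕ → Poly
xn-1 zero    = []
xn-1 (suc k) = ℤ.-[1+ 0 ] ∷ (replicate k (+ 0) ++ (+ 1 ∷ []))

-- Long division by a monic polynomial, with coefficient lists HIGH degree
-- first.  subFront c r d = r - c·d (aligned at the front).
subFront : ℤ → List ℤ → List ℤ → List ℤ
subFront c []       _        = []
subFront c rs       []       = rs
subFront c (r ∷ rs) (d ∷ ds) = (r ℤ.- c ℤ.* d) ∷ subFront c rs ds

-- divHi k p (1 ∷ dt): the first k quotient coefficients of p ÷ (1 ∷ dt).
divHi : ℕ → List ℤ → List ℤ → List ℤ
divHi zero    _        _  = []
divHi (suc k) []       dt = []
divHi (suc k) (r ∷ rs) dt = r ∷ divHi k (subFront r rs dt) dt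

tailL : List ℤ → List ℤ
tailL []       = []
tailL (_ ∷ xs) = xs

divMonic : Poly → Poly → Poly
divMonic p d =
  reverse (divHi (length p ℕ.∸ (length d ℕ.∸ 1)) (reverse p) (tailL (reverse d)))

-- product of the entries of a table [φ_i, φ_{i+1}, …] whose index divides n
prodDiv : ℕ → ℕ → List Poly → Poly
prodDiv n i []       = oneP
prodDiv n i (p ∷ ps) =
  if ⌊ i ∣? n ⌋ then mulP p (prodDiv n (suc i) ps) else prodDiv n (suc i) ps

-- cycTable k = [φ_1, …, φ_k], via  φ_n = (X^n - 1) / ∏_{d ∣ n, d < n} φ_d
cycTable : ℕ → List Poly
cycTable zero    = []
cycTable (suc k) =
  cycTable k ++ (divMonic (xn-1 (suc k)) (prodDiv (suc k) 1 (cycTable k)) ∷ [])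

lastP : List Poly → Poly
lastP []       = oneP
lastP (p ∷ []) = p
lastP (_ ∷ ps) = lastP ps

cyclo : ℕ → Poly
cyclo n = lastP (cycTable n)

homEval : ℕ → Poly → ℤ → ℤ → ℤ
homEval e p x y = go 0 p
  where
  go : ℕ → Poly → ℤ
  go i []      = + 0
  go i (c ∷ cs) = c ℤ.* (x ℤ.^ i) ℤ.* (y ℤ.^ (e ℕ.∸ i)) ℤ.+ go (suc i) cs

-- cyclotomic binary form Φ_n(X,Y) = Y^φ(n) φ_n(X/Y)
Φ : ℕ → ℤ → ℤ → ℤ
Φ n x y = homEval (totient n) (cyclo n) x y

{-# OPTIONS --safe #-}

-- Only the recursion of the cyclotomic forms along primes is needed, no complex roots.
-- For a ≥ 2 the numbers a^d - 1 form a strong divisibility sequence, so ∏_{d ∣ n, d < n} φ_d(a)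
-- is the least common multiple of the a^d - 1 and divides a^n - 1.  As this holds for all large a,
-- the long division defining φ_n is exact, and ∏_{d ∣ n} Φ_d(x, y) = x^n - y^n.  By uniqueness
--   Φ_{np}(x, y) = Φ_n(x^p, y^p) if p ∣ n,   Φ_{np}(x, y) Φ_n(x, y) = Φ_n(x^p, y^p) if p ∤ n
-- whenever |x| ≠ |y|.  Let M = |x| > |y|.  For s = p or 2p with p an odd prime, Φ_s is (up to the
-- sign of y) the quotient (x^p - y^p)/(x - y), which lies between M^(p-1) and p M^(p-1) if x y ≥ 0
-- and between M^(p-1)/2 and M^(p-1) otherwise.  A second odd prime q gives bounds 1/p and p for
-- Φ_{sq} / M^φ(sq), and every further odd prime at worst squares the constant while φ at least
-- doubles, so the inequality B² 3^φ ≤ 4^φ propagates.  The cases s = 3, 5, 6, 10 need sums of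
-- squares, and repeated primes are free by the first recursion.
-- If |x| = |y|, then Φ_n(x, y) is a non-zero multiple of x^φ(n).
module Submission where

open import Defs
open import Data.Nat using (ℕ; _≤_; _*_; _^_; _⊔_)
open import Data.Integer using (ℤ; +_; ∣_∣)
open import Relation.Binary.PropositionalEquality using (_≡_)
open import Data.Product using (_×_)
open import Algebra.Structures using (IsCommutativeMonoid)
open import Data.Bool using (true; false; if_then_else_)
open import Data.Integer as ℤ using (-[1+_]; 0ℤ; 1ℤ)
import Data.Integer.Divisibility.Signed as ℤ
import Data.Integer.Properties as ℤ
import Data.Integer.Tactic.RingSolver as ℤ-Solver
open import Data.List using (List; []; _∷_; _++_; reverse; replicate; length; map)
open import Data.List.Properties using (unfold-reverse; length-reverse; length-++; reverse-++; length-replicate)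
open import Data.List.Relation.Unary.All using (All; []; _∷_)
open import Data.Nat.Base
open import Data.Nat.Coprimality as Coprimality using (Coprime; coprime-divisor; coprime⇒gcd≡1; gcd≡1⇒coprime; coprime-+)
open import Data.Nat.Divisibility
open import Data.Nat.GCD using (gcd; gcd[m,n]∣m; gcd[m,n]∣n; gcd-GCD; module Bézout)
open import Data.Nat.Induction using (<-rec)
open import Data.Nat.ListAction using (product; sum)
open import Data.Nat.Primality
open import Data.Nat.Primality.Factorisation using (factorise; module PrimeFactorisation)
open import Data.Nat.Properties
open import Data.Nat.Tactic.RingSolver using (solve-∀)
open import Data.Product using (∃; _,_; proj₁; proj₂)
open import Data.Sum using (_⊎_; inj₁; inj₂)
open import Function using (_∘_)
open import Relation.Binary.Definitions using (tri<; tri≈; tri>)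
open import Relation.Binary.PropositionalEquality using (_≢_; refl; sym; trans; cong; cong₂; subst; subst₂; module ≡-Reasoning)
open import Relation.Nullary using (¬_; Dec; yes; no; contradiction)
open import Relation.Nullary.Decidable using (⌊_⌋; ¬?; _×-dec_)

-- Finite products over divisors, and the totient

-- Write φ for `totient n` and max for `∣ x ∣ ⊔ ∣ y ∣`. Without logarithms and roots the two
-- inequalities read `3 ^ φ ≤ m ^ 2` and `3 ^ φ * max ^ (2 * φ) ≤ 4 ^ φ * m ^ 2`; the first follows
-- from the second because max ≥ 2. The second asks for |Φ_n(x, y)| ≥ (√3/2)^φ max^φ. Both are
-- equalities at Φ_3(2, -1) = 3, so n = 3 leaves no slack. For p = 3 and p = 5 the general constant
-- 1/2 lies below the required (3/4)^((p-1)/2), which is why these primes need their own identities;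
-- from p = 7 on it suffices. The condition B² 3^φ ≤ 4^φ means B ≤ (2/√3)^φ, so B² is admissible as
-- soon as φ doubles.

prime∤⇒coprime : ∀ {p i} → Prime p → ¬ p ∣ i → Coprime i p
prime∤⇒coprime pr p∤i (d∣i , d∣p) with prime⇒irreducible pr d∣p
... | inj₁ d≡1  = d≡1
... | inj₂ refl = contradiction d∣i p∤i

coprime-* : ∀ {i} a b → Coprime i a → Coprime i b → Coprime i (a * b)
coprime-* a b i⊥a i⊥b (d∣i , d∣ab) =
  i⊥b (d∣i , coprime-divisor (λ (e∣d , e∣a) → i⊥a (∣-trans e∣d d∣i , e∣a)) d∣ab)

-- The same divisor combinatorics serves sums of totients, which are the degrees, and products of
-- forms, which are the values. Products start at index 1, as only positive divisors occur.
module Products {A : Set} (_∙_ : A → A → A) (ε : A) (isCM : IsCommutativeMonoid _≡_ _∙_ ε) where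

  open IsCommutativeMonoid isCM using (assoc; identityˡ; identityʳ; comm)
  open ≡-Reasoning

  ∏ : (ℕ → A) → ℕ → A
  ∏ f zero    = ε
  ∏ f (suc n) = ∏ f n ∙ f (suc n)

  when : ∀ {P : Set} → Dec P → A → A
  when P? a = if ⌊ P? ⌋ then a else ε

  ∏-divisors : (ℕ → A) → ℕ → A
  ∏-divisors f n = ∏ (λ d → when (d ∣? n) (f d)) n

  when-yes : ∀ {P : Set} (P? : Dec P) {a} → P → when P? a ≡ a
  when-yes (yes _) p = refl
  when-yes (no ¬p) p = contradiction p ¬p

  when-no : ∀ {P : Set} (P? : Dec P) {a} → ¬ P → when P? a ≡ ε
  when-no (yes p) ¬p = contradiction p ¬p
  when-no (no _)  ¬p = refl

  when-⇔ : ∀ {P Q : Set} (P? : Dec P) (Q? : Dec Q) {a} → (P → Q) → (Q → P) → when P? a ≡ when Q? a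
  when-⇔ (yes p) Q? f g = sym (when-yes Q? (f p))
  when-⇔ (no ¬p) Q? f g = sym (when-no Q? (¬p ∘ g))

  when-∙ : ∀ {P : Set} (P? : Dec P) a b → when P? (a ∙ b) ≡ when P? a ∙ when P? b
  when-∙ (yes _) a b = refl
  when-∙ (no _)  a b = sym (identityˡ ε)

  when-when : ∀ {P Q : Set} (P? : Dec P) (Q? : Dec Q) a →
              when P? (when Q? a) ≡ when (P? ×-dec Q?) a
  when-when (yes _) (yes _) a = refl
  when-when (yes _) (no _)  a = refl
  when-when (no _)  Q?      a = refl

  ∏-cong : ∀ {f g} n → (∀ i → 1 ≤ i → i ≤ n → f i ≡ g i) → ∏ f n ≡ ∏ g n
  ∏-cong zero    f≗g = refl
  ∏-cong (suc n) f≗g =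
    cong₂ _∙_ (∏-cong n (λ i 1≤i i≤n → f≗g i 1≤i (m≤n⇒m≤1+n i≤n))) (f≗g (suc n) (s≤s z≤n) ≤-refl)

  ∏-ε : ∀ n → ∏ (λ _ → ε) n ≡ ε
  ∏-ε zero    = refl
  ∏-ε (suc n) = trans (identityʳ _) (∏-ε n)

  interchange : ∀ a b c d → (a ∙ b) ∙ (c ∙ d) ≡ (a ∙ c) ∙ (b ∙ d)
  interchange a b c d = begin
    (a ∙ b) ∙ (c ∙ d) ≡⟨ assoc a b (c ∙ d) ⟩
    a ∙ (b ∙ (c ∙ d)) ≡⟨ cong (a ∙_) (assoc b c d) ⟨
    a ∙ ((b ∙ c) ∙ d) ≡⟨ cong (λ z → a ∙ (z ∙ d)) (comm b c) ⟩
    a ∙ ((c ∙ b) ∙ d) ≡⟨ cong (a ∙_) (assoc c b d) ⟩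
    a ∙ (c ∙ (b ∙ d)) ≡⟨ assoc a c (b ∙ d) ⟨
    (a ∙ c) ∙ (b ∙ d) ∎

  ∏-∙ : ∀ f g n → ∏ (λ i → f i ∙ g i) n ≡ ∏ f n ∙ ∏ g n
  ∏-∙ f g zero    = sym (identityˡ ε)
  ∏-∙ f g (suc n) = trans (cong (_∙ (f (suc n) ∙ g (suc n))) (∏-∙ f g n)) (interchange _ _ _ _)

  ∏-+ : ∀ f m n → ∏ f (m + n) ≡ ∏ f m ∙ ∏ (λ i → f (m + i)) n
  ∏-+ f m zero    = trans (cong (∏ f) (+-identityʳ m)) (sym (identityʳ _))
  ∏-+ f m (suc n) = begin
    ∏ f (m + suc n)                                      ≡⟨ cong (∏ f) (+-suc m n) ⟩
    ∏ f (m + n) ∙ f (suc (m + n))                        ≡⟨ cong₂ _∙_ (∏-+ f m n) (cong f (sym (+-suc m n))) ⟩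
    (∏ f m ∙ ∏ (λ i → f (m + i)) n) ∙ f (m + suc n)      ≡⟨ assoc _ _ _ ⟩
    ∏ f m ∙ (∏ (λ i → f (m + i)) n ∙ f (m + suc n))      ∎

  -- Cut 1, ..., m p into m blocks of length p: the last entry of each block is its only multiple of
  -- p.
  ∏-split : ∀ f p .{{_ : NonZero p}} m →
            ∏ f (m * p) ≡ ∏ (λ j → f (j * p)) m ∙ ∏ (λ i → when (¬? (p ∣? i)) (f i)) (m * p)
  ∏-split f p@(suc p′) zero    = sym (identityˡ ε)
  ∏-split f p@(suc p′) (suc m) = begin
    ∏ f (p + m * p)                                    ≡⟨ cong (∏ f) (+-comm p (m * p)) ⟩
    ∏ f (m * p + p)                                    ≡⟨ ∏-+ f (m * p) p ⟩
    ∏ f (m * p) ∙ ∏ (λ i → f (m * p + i)) p            ≡⟨ cong₂ _∙_ (∏-split f p m) block ⟩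
    (∏ (λ j → f (j * p)) m ∙ ∏ f′ (m * p)) ∙ (f (suc m * p) ∙ ∏ (λ i → f′ (m * p + i)) p)
                                                       ≡⟨ interchange _ _ _ _ ⟩
    ∏ (λ j → f (j * p)) (suc m) ∙ (∏ f′ (m * p) ∙ ∏ (λ i → f′ (m * p + i)) p)
                                                       ≡⟨ cong (∏ (λ j → f (j * p)) (suc m) ∙_) (∏-+ f′ (m * p) p) ⟨
    ∏ (λ j → f (j * p)) (suc m) ∙ ∏ f′ (m * p + p)     ≡⟨ cong (λ k → ∏ (λ j → f (j * p)) (suc m) ∙ ∏ f′ k) (+-comm (m * p) p) ⟩
    ∏ (λ j → f (j * p)) (suc m) ∙ ∏ f′ (p + m * p)     ∎
    where
    f′ : ℕ → A
    f′ i = when (¬? (p ∣? i)) (f i)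
    p∣mp+p : p ∣ m * p + p
    p∣mp+p = ∣m∣n⇒∣m+n (n∣m*n m) ∣-refl
    within : ∀ i → 1 ≤ i → i ≤ p′ → f (m * p + i) ≡ f′ (m * p + i)
    within i 1≤i i≤p′ = sym (when-yes (¬? (p ∣? (m * p + i))) λ p∣mp+i →
      <⇒≱ (s≤s i≤p′) (∣⇒≤ {{>-nonZero 1≤i}} (∣m+n∣m⇒∣n p∣mp+i (n∣m*n m))))
    block : ∏ (λ i → f (m * p + i)) p ≡ f (suc m * p) ∙ ∏ (λ i → f′ (m * p + i)) p
    block = begin
      ∏ (λ i → f (m * p + i)) p′ ∙ f (m * p + p)  ≡⟨ comm _ _ ⟩
      f (m * p + p) ∙ ∏ (λ i → f (m * p + i)) p′  ≡⟨ cong₂ _∙_ (cong f (+-comm (m * p) p)) (∏-cong p′ within) ⟩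
      f (p + m * p) ∙ ∏ (λ i → f′ (m * p + i)) p′ ≡⟨ cong (f (p + m * p) ∙_) (identityʳ _) ⟨
      f (p + m * p) ∙ (∏ (λ i → f′ (m * p + i)) p′ ∙ ε)
        ≡⟨ cong (λ z → f (p + m * p) ∙ (∏ (λ i → f′ (m * p + i)) p′ ∙ z)) (when-no (¬? (p ∣? (m * p + p))) (λ ¬p∣ → ¬p∣ p∣mp+p)) ⟨
      f (p + m * p) ∙ ∏ (λ i → f′ (m * p + i)) p  ∎

  ∏-trivial-tail : ∀ f m k → (∀ i → m < i → f i ≡ ε) → ∏ f (m + k) ≡ ∏ f m
  ∏-trivial-tail f m k tail = begin
    ∏ f (m + k)                     ≡⟨ ∏-+ f m k ⟩
    ∏ f m ∙ ∏ (λ i → f (m + i)) k   ≡⟨ cong (_ ∙_) (∏-cong k (λ i 1≤i _ → tail (m + i) (m<m+n m 1≤i))) ⟩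
    ∏ f m ∙ ∏ (λ _ → ε) k           ≡⟨ cong (_ ∙_) (∏-ε k) ⟩
    ∏ f m ∙ ε                       ≡⟨ identityʳ _ ⟩
    ∏ f m                           ∎

  -- A divisor of m p is either d p with d ∣ m, or a divisor of m prime to p.
  ∏-divisors-*-prime : ∀ g {p} → Prime p → ∀ m .{{_ : NonZero m}} →
    ∏-divisors g (m * p) ≡ ∏-divisors (λ d → g (d * p) ∙ when (¬? (p ∣? d)) (g d)) m
  ∏-divisors-*-prime g {p} pr m = begin
    ∏ G (m * p)                       ≡⟨ ∏-split G p m ⟩
    ∏ (λ j → G (j * p)) m ∙ ∏ (λ i → when (¬? (p ∣? i)) (G i)) (m * p)
      ≡⟨ cong₂ _∙_ (∏-cong m multiples) (trans (∏-cong (m * p) others) (trans (cong (∏ G″) m*p≡m+k) (∏-trivial-tail G″ m (m * p ∸ m) tail))) ⟩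
    ∏ G′ m ∙ ∏ G″ m                   ≡⟨ ∏-∙ G′ G″ m ⟨
    ∏ (λ d → G′ d ∙ G″ d) m           ≡⟨ ∏-cong m (λ d _ _ → sym (when-∙ (d ∣? m) _ _)) ⟩
    ∏-divisors (λ d → g (d * p) ∙ when (¬? (p ∣? d)) (g d)) m ∎
    where
    instance
      p≢0 : NonZero p
      p≢0 = prime⇒nonZero pr
    G G′ G″ : ℕ → A
    G i  = when (i ∣? (m * p)) (g i)
    G′ d = when (d ∣? m) (g (d * p))
    G″ d = when (d ∣? m) (when (¬? (p ∣? d)) (g d))
    multiples : ∀ j → 1 ≤ j → j ≤ m → G (j * p) ≡ G′ j
    multiples j _ _ = when-⇔ ((j * p) ∣? (m * p)) (j ∣? m) (*-cancelʳ-∣ p) (*-monoˡ-∣ p)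
    others : ∀ i → 1 ≤ i → i ≤ m * p → when (¬? (p ∣? i)) (G i) ≡ G″ i
    others i _ _ = begin
      when (¬? (p ∣? i)) (G i)                       ≡⟨ when-when (¬? (p ∣? i)) (i ∣? (m * p)) (g i) ⟩
      when (¬? (p ∣? i) ×-dec (i ∣? (m * p))) (g i)
        ≡⟨ when-⇔ (¬? (p ∣? i) ×-dec (i ∣? (m * p))) ((i ∣? m) ×-dec ¬? (p ∣? i))
             (λ (p∤i , i∣mp) → coprime-divisor (prime∤⇒coprime pr p∤i) (subst (i ∣_) (*-comm m p) i∣mp) , p∤i)
             (λ (i∣m , p∤i) → p∤i , ∣-trans i∣m (m∣m*n p)) ⟩
      when ((i ∣? m) ×-dec ¬? (p ∣? i)) (g i)        ≡⟨ when-when (i ∣? m) (¬? (p ∣? i)) (g i) ⟨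
      G″ i                                           ∎
    tail : ∀ i → m < i → G″ i ≡ ε
    tail i m<i = when-no (i ∣? m) (λ i∣m → <⇒≱ m<i (∣⇒≤ i∣m))
    m*p≡m+k : m * p ≡ m + (m * p ∸ m)
    m*p≡m+k = sym (m+[n∸m]≡n (m≤m*n m p))

module Sums = Products _+_ 0 +-0-isCommutativeMonoid

open Sums using () renaming (∏ to ∑; ∏-divisors to ∑-divisors; when to ind)

mutual
  totient-∑ : ∀ n → totient n ≡ ∑ (λ i → ind (gcd i n ≟ 1) 1) n
  totient-∑ zero = refl
  totient-∑ (suc k) with ⌊ gcd (suc k) (suc k) ≟ 1 ⌋
  -- Abstracting `suc k` turns the modulus into a variable `N`, so that the placeholder of `go-∑`,
  -- applied to `N` and `k`, has a unique solution.
  ... | true with suc k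
  ...   | N = trans (cong suc (go-∑ N k)) (+-comm 1 _)
  totient-∑ (suc k) | false with suc k
  ...   | N = trans (go-∑ N k) (sym (+-identityʳ _))

  -- The left-hand side, solved by unification, is the local function of totient.
  go-∑ : ∀ n k → _ ≡ ∑ (λ i → ind (gcd i n ≟ 1) 1) k
  go-∑ n zero = refl
  go-∑ n (suc k) with ⌊ gcd (suc k) n ≟ 1 ⌋
  ... | true  = trans (cong suc (go-∑ n k)) (+-comm 1 _)
  ... | false = trans (go-∑ n k) (sym (+-identityʳ _))

∑-periodic : ∀ f m k → (∀ i → f (m + i) ≡ f i) → ∑ f (k * m) ≡ k * ∑ f m
∑-periodic f m zero    per = refl
∑-periodic f m (suc k) per =
  trans (Sums.∏-+ f m (k * m))
        (cong (λ i → ∑ f m + i) (trans (Sums.∏-cong (k * m) (λ i _ _ → per i)) (∑-periodic f m k per)))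

-- Among 1, ..., m p there are p φ(m) numbers prime to m, by periodicity. Those also prime to p are
-- counted by φ(m p); a multiple j p is prime to m exactly when p ∤ m and j is prime to m.
totient-*-prime : ∀ {p} → Prime p → ∀ m .{{_ : NonZero m}} →
  totient (m * p) + ind (¬? (p ∣? m)) (totient m) ≡ p * totient m
totient-*-prime {p} pr m = begin
  totient (m * p) + ind (¬? (p ∣? m)) (totient m)
    ≡⟨ cong₂ _+_ (trans (totient-∑ (m * p)) (Sums.∏-cong (m * p) (λ i _ _ → sym (others i)))) multiples ⟩
  ∑ (λ i → ind (¬? (p ∣? i)) (c i)) (m * p) + ∑ (λ j → c (j * p)) m
    ≡⟨ +-comm _ (∑ (λ j → c (j * p)) m) ⟩
  ∑ (λ j → c (j * p)) m + ∑ (λ i → ind (¬? (p ∣? i)) (c i)) (m * p)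
    ≡⟨ Sums.∏-split c p m ⟨
  ∑ c (m * p)       ≡⟨ cong (∑ c) (*-comm m p) ⟩
  ∑ c (p * m)       ≡⟨ ∑-periodic c m p periodic ⟩
  p * ∑ c m         ≡⟨ cong (p *_) (totient-∑ m) ⟨
  p * totient m     ∎
  where
  open ≡-Reasoning
  instance
    p≢0 : NonZero p
    p≢0 = prime⇒nonZero pr
  c : ℕ → ℕ
  c i = ind (gcd i m ≟ 1) 1
  p≢1 : p ≢ 1
  p≢1 refl = ¬prime[1] pr
  periodic : ∀ i → c (m + i) ≡ c i
  periodic i = Sums.when-⇔ (gcd (m + i) m ≟ 1) (gcd i m ≟ 1)
    (λ eq → coprime⇒gcd≡1 λ (d∣i , d∣m) → gcd≡1⇒coprime {m + i} eq (∣m∣n⇒∣m+n d∣m d∣i , d∣m))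
    (λ eq → coprime⇒gcd≡1 (coprime-+ {i} (gcd≡1⇒coprime {i} eq)))
  others : ∀ i → ind (¬? (p ∣? i)) (c i) ≡ ind (gcd i (m * p) ≟ 1) 1
  others i = trans (Sums.when-when (¬? (p ∣? i)) (gcd i m ≟ 1) 1)
    (Sums.when-⇔ (¬? (p ∣? i) ×-dec (gcd i m ≟ 1)) (gcd i (m * p) ≟ 1)
      (λ (p∤i , eq) → coprime⇒gcd≡1 (coprime-* m p (gcd≡1⇒coprime {i} eq) (prime∤⇒coprime pr p∤i)))
      (λ eq → (λ p∣i → p≢1 (gcd≡1⇒coprime {i} eq (p∣i , n∣m*n m)))
            , coprime⇒gcd≡1 (λ (d∣i , d∣m) → gcd≡1⇒coprime {i} eq (d∣i , ∣m⇒∣m*n p d∣m))))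
  when-c : ∀ j → c (j * p) ≡ ind (¬? (p ∣? m)) (c j)
  when-c j = sym (trans (Sums.when-when (¬? (p ∣? m)) (gcd j m ≟ 1) 1)
    (Sums.when-⇔ (¬? (p ∣? m) ×-dec (gcd j m ≟ 1)) (gcd (j * p) m ≟ 1)
      (λ (p∤m , eq) → coprime⇒gcd≡1 (Coprimality.sym (coprime-* j p (Coprimality.sym (gcd≡1⇒coprime {j} eq)) (prime∤⇒coprime pr p∤m))))
      (λ eq → (λ p∣m → p≢1 (gcd≡1⇒coprime {j * p} eq (n∣m*n j , p∣m)))
            , coprime⇒gcd≡1 {j} (λ (d∣j , d∣m) → gcd≡1⇒coprime {j * p} eq (∣m⇒∣m*n p d∣j , d∣m)))))
  multiples : ind (¬? (p ∣? m)) (totient m) ≡ ∑ (λ j → c (j * p)) m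
  multiples = trans pull (Sums.∏-cong m (λ j _ _ → sym (when-c j)))
    where
    pull : ind (¬? (p ∣? m)) (totient m) ≡ ∑ (λ j → ind (¬? (p ∣? m)) (c j)) m
    pull with ¬? (p ∣? m)
    ... | yes _ = totient-∑ m
    ... | no _  = sym (Sums.∏-ε m)

prime-induction : (P : ℕ → Set) → P 1 →
  (∀ {p} → Prime p → ∀ m .{{_ : NonZero m}} → P m → P (m * p)) → ∀ n .{{_ : NonZero n}} → P n
prime-induction P P1 step n = subst P (sym isFactorisation) (go _ factorsPrime)
  where
  open PrimeFactorisation (factorise n)
  go : ∀ ps → All Prime ps → P (product ps)
  go []       []         = P1
  go (p ∷ ps) (pr ∷ prs) =
    subst P (*-comm _ p) (step pr (product ps) {{>-nonZero (productOfPrimes≥1 prs)}} (go ps prs))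

∑-*ˡ : ∀ c f n → ∑ (λ i → c * f i) n ≡ c * ∑ f n
∑-*ˡ c f zero    = sym (*-zeroʳ c)
∑-*ˡ c f (suc n) = trans (cong (_+ c * f (suc n)) (∑-*ˡ c f n)) (sym (*-distribˡ-+ c _ _))

-- Gauss's identity, by the same splitting of divisors along a prime. It makes the degrees in the
-- defining division add up to n, so that `cyclo n` has degree `totient n`.
∑-totient : ∀ n .{{_ : NonZero n}} → ∑-divisors totient n ≡ n
∑-totient = prime-induction (λ n → ∑-divisors totient n ≡ n) refl step
  where
  open ≡-Reasoning
  step : ∀ {p} → Prime p → ∀ m .{{_ : NonZero m}} → ∑-divisors totient m ≡ m → ∑-divisors totient (m * p) ≡ m * p
  step {p} pr m ih = begin
    ∑-divisors totient (m * p)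
      ≡⟨ Sums.∏-divisors-*-prime totient pr m ⟩
    ∑-divisors (λ d → totient (d * p) + ind (¬? (p ∣? d)) (totient d)) m
      ≡⟨ Sums.∏-cong m (λ d 1≤d _ → trans (cong (ind (d ∣? m)) (totient-*-prime pr d {{>-nonZero 1≤d}})) (pull d)) ⟩
    ∑ (λ d → p * ind (d ∣? m) (totient d)) m
      ≡⟨ ∑-*ˡ p _ m ⟩
    p * ∑-divisors totient m
      ≡⟨ cong (p *_) ih ⟩
    p * m ≡⟨ *-comm p m ⟩
    m * p ∎
    where
    pull : ∀ d → ind (d ∣? m) (p * totient d) ≡ p * ind (d ∣? m) (totient d)
    pull d with d ∣? m
    ... | yes _ = refl
    ... | no _  = sym (*-zeroʳ p)

-- Coefficient lists as binary forms

-- The homogenisation of p of degree length p - 1.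
form : Poly → ℤ → ℤ → ℤ
form []       x y = 0ℤ
form (c ∷ cs) x y = c ℤ.* y ℤ.^ length cs ℤ.+ x ℤ.* form cs x y

private
  homEvalFrom : ℕ → ℤ → ℤ → ℕ → Poly → ℤ
  homEvalFrom e x y i []       = 0ℤ
  homEvalFrom e x y i (c ∷ cs) =
    c ℤ.* (x ℤ.^ i) ℤ.* (y ℤ.^ (e ∸ i)) ℤ.+ homEvalFrom e x y (suc i) cs

  mutual
    homEval-from : ∀ e p x y → homEval e p x y ≡ homEvalFrom e x y 0 p
    homEval-from e []       x y = refl
    homEval-from e (c ∷ cs) x y with c ℤ.* 1ℤ ℤ.* y ℤ.^ e
    -- As for `totient`, the arguments of the hidden local function become variables, so that the
    -- placeholder of `go-from` can be solved.
    ... | w with c ∷ cs | 1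
    ...   | p | i = cong (λ z → w ℤ.+ z) (go-from e p x y i cs)

    go-from : ∀ e p x y i cs → _ ≡ homEvalFrom e x y i cs
    go-from e p x y i []       = refl
    go-from e p x y i (c ∷ cs) =
      cong (λ z → c ℤ.* (x ℤ.^ i) ℤ.* (y ℤ.^ (e ∸ i)) ℤ.+ z) (go-from e p x y (suc i) cs)

  homEvalFrom-form : ∀ x y p i → homEvalFrom (i + (length p ∸ 1)) x y i p ≡ x ℤ.^ i ℤ.* form p x y
  homEvalFrom-form x y []       i = sym (ℤ.*-zeroʳ (x ℤ.^ i))
  homEvalFrom-form x y (c ∷ []) i rewrite +-identityʳ i | n∸n≡0 i = lemma c (x ℤ.^ i) x
    where
    lemma : ∀ c u x → c ℤ.* u ℤ.* 1ℤ ℤ.+ 0ℤ ≡ u ℤ.* (c ℤ.* 1ℤ ℤ.+ x ℤ.* 0ℤ)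
    lemma = ℤ-Solver.solve-∀
  homEvalFrom-form x y (c ∷ cs@(_ ∷ cs′)) i = begin
    c ℤ.* (x ℤ.^ i) ℤ.* (y ℤ.^ (i + length cs ∸ i)) ℤ.+ homEvalFrom (i + length cs) x y (suc i) cs
      ≡⟨ cong₂ (λ j z → c ℤ.* (x ℤ.^ i) ℤ.* (y ℤ.^ j) ℤ.+ z) (m+n∸m≡n i (length cs))
          (trans (cong (λ e → homEvalFrom e x y (suc i) cs) (+-suc i (length cs′)))
                 (homEvalFrom-form x y cs (suc i))) ⟩
    c ℤ.* (x ℤ.^ i) ℤ.* (y ℤ.^ length cs) ℤ.+ x ℤ.* x ℤ.^ i ℤ.* form cs x y
      ≡⟨ lemma c (x ℤ.^ i) (y ℤ.^ length cs) x (form cs x y) ⟩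
    x ℤ.^ i ℤ.* form (c ∷ cs) x y ∎
    where
    open ≡-Reasoning
    lemma : ∀ c u v x f → c ℤ.* u ℤ.* v ℤ.+ x ℤ.* u ℤ.* f ≡ u ℤ.* (c ℤ.* v ℤ.+ x ℤ.* f)
    lemma = ℤ-Solver.solve-∀

-- `form` takes its degree from the length of the list while `homEval` is told `e`, so the two agree
-- when `e` is the actual degree; hence the need for the exact length of `cyclo n`.
homEval-form : ∀ p {e} x y → length p ≡ suc e → homEval e p x y ≡ form p x y
homEval-form p@(_ ∷ _) x y refl =
  trans (homEval-from _ p x y) (trans (homEvalFrom-form x y p 0) (ℤ.*-identityˡ (form p x y)))

form-∷ʳ : ∀ p c x y → form (p ++ c ∷ []) x y ≡ y ℤ.* form p x y ℤ.+ c ℤ.* x ℤ.^ length p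
form-∷ʳ []       c x y = lemma c x y
  where
  lemma : ∀ c x y → c ℤ.* 1ℤ ℤ.+ x ℤ.* 0ℤ ≡ y ℤ.* 0ℤ ℤ.+ c ℤ.* 1ℤ
  lemma = ℤ-Solver.solve-∀
form-∷ʳ (b ∷ p) c x y = begin
  b ℤ.* y ℤ.^ length (p ++ c ∷ []) ℤ.+ x ℤ.* form (p ++ c ∷ []) x y
    ≡⟨ cong₂ (λ k z → b ℤ.* y ℤ.^ k ℤ.+ x ℤ.* z) (trans (length-++ p) (+-comm (length p) 1)) (form-∷ʳ p c x y) ⟩
  b ℤ.* (y ℤ.* y ℤ.^ length p) ℤ.+ x ℤ.* (y ℤ.* form p x y ℤ.+ c ℤ.* x ℤ.^ length p)
    ≡⟨ lemma b c x y (y ℤ.^ length p) (x ℤ.^ length p) (form p x y) ⟩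
  y ℤ.* (b ℤ.* y ℤ.^ length p ℤ.+ x ℤ.* form p x y) ℤ.+ c ℤ.* (x ℤ.* x ℤ.^ length p) ∎
  where
  open ≡-Reasoning
  lemma : ∀ b c x y u v f → b ℤ.* (y ℤ.* u) ℤ.+ x ℤ.* (y ℤ.* f ℤ.+ c ℤ.* v)
                          ≡ y ℤ.* (b ℤ.* u ℤ.+ x ℤ.* f) ℤ.+ c ℤ.* (x ℤ.* v)
  lemma = ℤ-Solver.solve-∀

-- The division works with the highest degree first. Such a list is still read by `form`, with the
-- variables exchanged, so one evaluation serves both conventions.
form-reverse : ∀ p x y → form (reverse p) x y ≡ form p y x
form-reverse []      x y = refl
form-reverse (c ∷ p) x y = begin
  form (reverse (c ∷ p)) x y
    ≡⟨ cong (λ q → form q x y) (unfold-reverse c p) ⟩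
  form (reverse p ++ c ∷ []) x y
    ≡⟨ form-∷ʳ (reverse p) c x y ⟩
  y ℤ.* form (reverse p) x y ℤ.+ c ℤ.* x ℤ.^ length (reverse p)
    ≡⟨ cong₂ (λ z k → y ℤ.* z ℤ.+ c ℤ.* x ℤ.^ k) (form-reverse p x y) (length-reverse p) ⟩
  y ℤ.* form p y x ℤ.+ c ℤ.* x ℤ.^ length p
    ≡⟨ ℤ.+-comm _ (c ℤ.* x ℤ.^ length p) ⟩
  form (c ∷ p) y x ∎
  where open ≡-Reasoning

form-scaleP : ∀ c p x y → form (scaleP c p) x y ≡ c ℤ.* form p x y
length-scaleP : ∀ c p → length (scaleP c p) ≡ length p
length-scaleP c []      = refl
length-scaleP c (_ ∷ p) = cong suc (length-scaleP c p)
form-scaleP c []      x y = sym (ℤ.*-zeroʳ c)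
form-scaleP c (b ∷ p) x y rewrite length-scaleP c p | form-scaleP c p x y =
  lemma c b (y ℤ.^ length p) x (form p x y)
  where
  lemma : ∀ c b u x f → c ℤ.* b ℤ.* u ℤ.+ x ℤ.* (c ℤ.* f) ≡ c ℤ.* (b ℤ.* u ℤ.+ x ℤ.* f)
  lemma = ℤ-Solver.solve-∀

length-addP : ∀ p q → length p ≤ length q → length (addP p q) ≡ length q
length-addP []      q       _         = refl
length-addP (_ ∷ p) (_ ∷ q) (s≤s p≤q) = cong suc (length-addP p q p≤q)

-- `addP` aligns constant terms, so the shorter summand is raised to the common degree by a power of
-- `y`.
form-addP : ∀ p q k x y → length q ≡ k + length p →
            form (addP p q) x y ≡ y ℤ.^ k ℤ.* form p x y ℤ.+ form q x y
form-addP []      q       k x y eq rewrite ℤ.*-zeroʳ (y ℤ.^ k) = sym (ℤ.+-identityˡ _)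
form-addP (a ∷ p) []      k x y eq = contradiction (trans eq (+-suc k _)) λ ()
form-addP (a ∷ p) (b ∷ q) k x y eq = begin
  (a ℤ.+ b) ℤ.* y ℤ.^ length (addP p q) ℤ.+ x ℤ.* form (addP p q) x y
    ≡⟨ cong₂ (λ i z → (a ℤ.+ b) ℤ.* y ℤ.^ i ℤ.+ x ℤ.* z)
         (length-addP p q (≤-trans (m≤n+m _ k) (≤-reflexive (sym eq′)))) (form-addP p q k x y eq′) ⟩
  (a ℤ.+ b) ℤ.* y ℤ.^ length q ℤ.+ x ℤ.* (y ℤ.^ k ℤ.* form p x y ℤ.+ form q x y)
    ≡⟨ lemma₁ a b (y ℤ.^ length q) x (y ℤ.^ k) (form p x y) (form q x y) ⟩
  a ℤ.* y ℤ.^ length q ℤ.+ y ℤ.^ k ℤ.* (x ℤ.* form p x y) ℤ.+ form (b ∷ q) x y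
    ≡⟨ cong (λ z → a ℤ.* z ℤ.+ y ℤ.^ k ℤ.* (x ℤ.* form p x y) ℤ.+ form (b ∷ q) x y)
         (trans (cong (y ℤ.^_) eq′) (ℤ.^-distribˡ-+-* y k (length p))) ⟩
  a ℤ.* (y ℤ.^ k ℤ.* y ℤ.^ length p) ℤ.+ y ℤ.^ k ℤ.* (x ℤ.* form p x y) ℤ.+ form (b ∷ q) x y
    ≡⟨ lemma₂ a (y ℤ.^ k) (y ℤ.^ length p) (x ℤ.* form p x y) (form (b ∷ q) x y) ⟩
  y ℤ.^ k ℤ.* form (a ∷ p) x y ℤ.+ form (b ∷ q) x y ∎
  where
  open ≡-Reasoning
  eq′ : length q ≡ k + length p
  eq′ = suc-injective (trans eq (+-suc k (length p)))
  lemma₁ : ∀ a b u x v f g → (a ℤ.+ b) ℤ.* u ℤ.+ x ℤ.* (v ℤ.* f ℤ.+ g)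
                            ≡ a ℤ.* u ℤ.+ v ℤ.* (x ℤ.* f) ℤ.+ (b ℤ.* u ℤ.+ x ℤ.* g)
  lemma₁ = ℤ-Solver.solve-∀
  lemma₂ : ∀ a u v f g → a ℤ.* (u ℤ.* v) ℤ.+ u ℤ.* f ℤ.+ g ≡ u ℤ.* (a ℤ.* v ℤ.+ f) ℤ.+ g
  lemma₂ = ℤ-Solver.solve-∀

-- The leading coefficient is split off at the end: after `reverse` it is the head 1 that `divMonic`
-- drops before dividing.
record Monic (e : ℕ) (p : Poly) : Set where
  constructor monic
  field
    lowerCoeffs        : List ℤ
    length-lowerCoeffs : length lowerCoeffs ≡ e
    decomposition        : p ≡ lowerCoeffs ++ 1ℤ ∷ []

  length-monic : length p ≡ suc e
  length-monic = trans (cong length decomposition) (trans (length-++ lowerCoeffs) (trans (+-comm _ 1) (cong suc length-lowerCoeffs)))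

  reverse-monic : reverse p ≡ 1ℤ ∷ reverse lowerCoeffs
  reverse-monic = trans (cong reverse decomposition) (reverse-++ lowerCoeffs (1ℤ ∷ []))

open Monic

addP-∷ʳ : ∀ p q c → length p ≤ length q → addP p (q ++ c ∷ []) ≡ addP p q ++ c ∷ []
addP-∷ʳ []      q       c _         = refl
addP-∷ʳ (a ∷ p) (b ∷ q) c (s≤s p≤q) = cong ((a ℤ.+ b) ∷_) (addP-∷ʳ p q c p≤q)

mulP-monic : ∀ {d e p q} → Monic d p → Monic e q → Monic (d + e) (mulP p q)
mulP-monic {e = e} {q = q} (monic l refl refl) mq = go l
  where
  scaleP-1 : ∀ p → scaleP 1ℤ p ≡ p
  scaleP-1 []      = refl
  scaleP-1 (a ∷ p) = cong₂ _∷_ (ℤ.*-identityˡ a) (scaleP-1 p)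
  addP-0 : ∀ p → 1 ≤ length p → addP p (0ℤ ∷ []) ≡ p
  addP-0 (a ∷ [])    _ = cong (_∷ []) (ℤ.+-identityʳ a)
  addP-0 (a ∷ b ∷ p) _ = cong (_∷ b ∷ p) (ℤ.+-identityʳ a)
  go : ∀ l → Monic (length l + e) (mulP (l ++ 1ℤ ∷ []) q)
  go []      = subst (Monic e) (sym (trans (cong (λ r → addP r (0ℤ ∷ [])) (scaleP-1 q))
                 (addP-0 q (≤-trans (s≤s z≤n) (≤-reflexive (sym (length-monic mq))))))) mq
  go (a ∷ l) = monic (addP (scaleP a q) (0ℤ ∷ lowerCoeffs ih))
                     (trans (length-addP (scaleP a q) (0ℤ ∷ lowerCoeffs ih) short) (cong suc (length-lowerCoeffs ih)))
                     (trans (cong (λ r → addP (scaleP a q) (0ℤ ∷ r)) (decomposition ih))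
                            (addP-∷ʳ (scaleP a q) (0ℤ ∷ lowerCoeffs ih) 1ℤ short))
    where
    ih : Monic (length l + e) (mulP (l ++ 1ℤ ∷ []) q)
    ih = go l
    short : length (scaleP a q) ≤ suc (length (lowerCoeffs ih))
    short = begin
      length (scaleP a q)     ≡⟨ trans (length-scaleP a q) (length-monic mq) ⟩
      suc e                   ≤⟨ s≤s (m≤n+m e (length l)) ⟩
      suc (length l + e)      ≡⟨ cong suc (length-lowerCoeffs ih) ⟨
      suc (length (lowerCoeffs ih)) ∎
      where open ≤-Reasoning

form-mulP : ∀ {d e p q} → Monic d p → Monic e q → ∀ x y →
            form (mulP p q) x y ≡ form p x y ℤ.* form q x y
form-mulP {e = e} {q = q} (monic l refl refl) mq x y = go l
  where
  open ≡-Reasoning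
  go : ∀ l → form (mulP (l ++ 1ℤ ∷ []) q) x y ≡ form (l ++ 1ℤ ∷ []) x y ℤ.* form q x y
  go []      = begin
    form (addP (scaleP 1ℤ q) (0ℤ ∷ [])) x y
      ≡⟨ cong (λ r → form r x y) (addP-comm-short (scaleP 1ℤ q) (trans (length-scaleP 1ℤ q) (length-monic mq))) ⟩
    form (addP (0ℤ ∷ []) (scaleP 1ℤ q)) x y
      ≡⟨ form-addP (0ℤ ∷ []) (scaleP 1ℤ q) e x y (trans (length-scaleP 1ℤ q) (trans (length-monic mq) (+-comm 1 e))) ⟩
    y ℤ.^ e ℤ.* (0ℤ ℤ.* 1ℤ ℤ.+ x ℤ.* 0ℤ) ℤ.+ form (scaleP 1ℤ q) x y
      ≡⟨ cong (λ z → y ℤ.^ e ℤ.* (0ℤ ℤ.* 1ℤ ℤ.+ x ℤ.* 0ℤ) ℤ.+ z) (form-scaleP 1ℤ q x y) ⟩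
    y ℤ.^ e ℤ.* (0ℤ ℤ.* 1ℤ ℤ.+ x ℤ.* 0ℤ) ℤ.+ 1ℤ ℤ.* form q x y
      ≡⟨ lemma (y ℤ.^ e) x (form q x y) ⟩
    (1ℤ ℤ.* 1ℤ ℤ.+ x ℤ.* 0ℤ) ℤ.* form q x y ∎
    where
    lemma : ∀ u x f → u ℤ.* (0ℤ ℤ.* 1ℤ ℤ.+ x ℤ.* 0ℤ) ℤ.+ 1ℤ ℤ.* f ≡ (1ℤ ℤ.* 1ℤ ℤ.+ x ℤ.* 0ℤ) ℤ.* f
    lemma = ℤ-Solver.solve-∀
    addP-comm-short : ∀ {k} p → length p ≡ suc k → addP p (0ℤ ∷ []) ≡ addP (0ℤ ∷ []) p
    addP-comm-short (a ∷ [])    _ = cong (_∷ []) (ℤ.+-comm a 0ℤ)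
    addP-comm-short (a ∷ b ∷ p) _ = cong (_∷ b ∷ p) (ℤ.+-comm a 0ℤ)
  go (a ∷ l) = begin
    form (addP (scaleP a q) (0ℤ ∷ mulP l₁ q)) x y
      ≡⟨ form-addP (scaleP a q) (0ℤ ∷ mulP l₁ q) (length l₁) x y
           (trans (cong suc (length-monic ml₁q))
             (trans (sym (cong suc (+-suc (length l) e)))
               (cong₂ _+_ (sym (length-monic ml₁)) (sym (trans (length-scaleP a q) (length-monic mq)))))) ⟩
    y ℤ.^ length l₁ ℤ.* form (scaleP a q) x y ℤ.+ (0ℤ ℤ.* y ℤ.^ length (mulP l₁ q) ℤ.+ x ℤ.* form (mulP l₁ q) x y)
      ≡⟨ cong₂ (λ z w → y ℤ.^ length l₁ ℤ.* z ℤ.+ (0ℤ ℤ.* y ℤ.^ length (mulP l₁ q) ℤ.+ x ℤ.* w)) (form-scaleP a q x y) (go l) ⟩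
    y ℤ.^ length l₁ ℤ.* (a ℤ.* form q x y) ℤ.+ (0ℤ ℤ.* y ℤ.^ length (mulP l₁ q) ℤ.+ x ℤ.* (form l₁ x y ℤ.* form q x y))
      ≡⟨ lemma (y ℤ.^ length l₁) a (form q x y) (y ℤ.^ length (mulP l₁ q)) x (form l₁ x y) ⟩
    (a ℤ.* y ℤ.^ length l₁ ℤ.+ x ℤ.* form l₁ x y) ℤ.* form q x y ∎
    where
    l₁ : Poly
    l₁ = l ++ 1ℤ ∷ []
    ml₁ : Monic (length l) l₁
    ml₁ = monic l refl refl
    ml₁q : Monic (length l + e) (mulP l₁ q)
    ml₁q = mulP-monic ml₁ mq
    lemma : ∀ u a f v x g → u ℤ.* (a ℤ.* f) ℤ.+ (0ℤ ℤ.* v ℤ.+ x ℤ.* (g ℤ.* f)) ≡ (a ℤ.* u ℤ.+ x ℤ.* g) ℤ.* f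
    lemma = ℤ-Solver.solve-∀

-- Long division by a monic list

remHi : ℕ → List ℤ → List ℤ → List ℤ
remHi zero    p        dt = p
remHi (suc k) []       dt = []
remHi (suc k) (r ∷ rs) dt = remHi k (subFront r rs dt) dt

length-subFront : ∀ c p q → length (subFront c p q) ≡ length p
length-subFront c []      q       = refl
length-subFront c (r ∷ p) []      = refl
length-subFront c (r ∷ p) (d ∷ q) = cong suc (length-subFront c p q)

form-subFront : ∀ c p q k x y → length p ≡ k + length q →
                form (subFront c p q) x y ≡ form p x y ℤ.+ ℤ.- (c ℤ.* (y ℤ.^ k ℤ.* form q x y))
form-subFront c []      []      k x y eq = lemma c (y ℤ.^ k)
  where
  lemma : ∀ c u → 0ℤ ≡ 0ℤ ℤ.+ ℤ.- (c ℤ.* (u ℤ.* 0ℤ))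
  lemma = ℤ-Solver.solve-∀
form-subFront c []      (d ∷ q) k x y eq = contradiction (trans eq (+-suc k _)) λ ()
form-subFront c (r ∷ p) []      k x y eq = lemma c (form (r ∷ p) x y) (y ℤ.^ k)
  where
  lemma : ∀ c f u → f ≡ f ℤ.+ ℤ.- (c ℤ.* (u ℤ.* 0ℤ))
  lemma = ℤ-Solver.solve-∀
form-subFront c (r ∷ p) (d ∷ q) k x y eq = begin
  (r ℤ.+ ℤ.- (c ℤ.* d)) ℤ.* y ℤ.^ length (subFront c p q) ℤ.+ x ℤ.* form (subFront c p q) x y
    ≡⟨ cong₂ (λ i z → (r ℤ.+ ℤ.- (c ℤ.* d)) ℤ.* i ℤ.+ x ℤ.* z)
         (trans (cong (y ℤ.^_) (trans (length-subFront c p q) eq′)) (ℤ.^-distribˡ-+-* y k (length q)))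
         (form-subFront c p q k x y eq′) ⟩
  (r ℤ.+ ℤ.- (c ℤ.* d)) ℤ.* (y ℤ.^ k ℤ.* y ℤ.^ length q) ℤ.+ x ℤ.* (form p x y ℤ.+ ℤ.- (c ℤ.* (y ℤ.^ k ℤ.* form q x y)))
    ≡⟨ lemma r c d (y ℤ.^ k) (y ℤ.^ length q) x (form p x y) (form q x y) ⟩
  r ℤ.* (y ℤ.^ k ℤ.* y ℤ.^ length q) ℤ.+ x ℤ.* form p x y ℤ.+ ℤ.- (c ℤ.* (y ℤ.^ k ℤ.* form (d ∷ q) x y))
    ≡⟨ cong (λ z → r ℤ.* z ℤ.+ x ℤ.* form p x y ℤ.+ ℤ.- (c ℤ.* (y ℤ.^ k ℤ.* form (d ∷ q) x y)))
         (trans (cong (y ℤ.^_) eq′) (ℤ.^-distribˡ-+-* y k (length q))) ⟨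
  form (r ∷ p) x y ℤ.+ ℤ.- (c ℤ.* (y ℤ.^ k ℤ.* form (d ∷ q) x y)) ∎
  where
  open ≡-Reasoning
  eq′ : length p ≡ k + length q
  eq′ = suc-injective (trans eq (+-suc k (length q)))
  lemma : ∀ r c d u v x f g →
    (r ℤ.+ ℤ.- (c ℤ.* d)) ℤ.* (u ℤ.* v) ℤ.+ x ℤ.* (f ℤ.+ ℤ.- (c ℤ.* (u ℤ.* g)))
    ≡ r ℤ.* (u ℤ.* v) ℤ.+ x ℤ.* f ℤ.+ ℤ.- (c ℤ.* (u ℤ.* (d ℤ.* v ℤ.+ x ℤ.* g)))
  lemma = ℤ-Solver.solve-∀

length-divHi : ∀ k p dt → length p ≡ k + length dt → length (divHi k p dt) ≡ k
length-divHi zero    p        dt eq = refl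
length-divHi (suc k) (r ∷ rs) dt eq =
  cong suc (length-divHi k (subFront r rs dt) dt (trans (length-subFront r rs dt) (suc-injective eq)))

length-remHi : ∀ k p dt → length p ≡ k + length dt → length (remHi k p dt) ≡ length dt
length-remHi zero    p        dt eq = eq
length-remHi (suc k) (r ∷ rs) dt eq =
  length-remHi k (subFront r rs dt) dt (trans (length-subFront r rs dt) (suc-injective eq))

-- Subtracting r times the divisor cancels the leading coefficient. As the highest degree comes
-- first here, dropping it takes out a factor `x`; k steps give the power in front of the remainder.
form-divHi : ∀ k p dt x y → length p ≡ k + length dt →
  form p x y ≡ form (divHi k p dt) x y ℤ.* form (1ℤ ∷ dt) x y ℤ.+ x ℤ.^ k ℤ.* form (remHi k p dt) x y
form-divHi zero    p        dt x y eq = lemma (form p x y) (form (1ℤ ∷ dt) x y)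
  where
  lemma : ∀ f g → f ≡ 0ℤ ℤ.* g ℤ.+ 1ℤ ℤ.* f
  lemma = ℤ-Solver.solve-∀
form-divHi (suc k) (r ∷ rs) dt x y eq = begin
  r ℤ.* y ℤ.^ length rs ℤ.+ x ℤ.* form rs x y
    ≡⟨ cong (λ z → r ℤ.* z ℤ.+ x ℤ.* form rs x y) (trans (cong (y ℤ.^_) eq′) (ℤ.^-distribˡ-+-* y k (length dt))) ⟩
  r ℤ.* (y ℤ.^ k ℤ.* y ℤ.^ length dt) ℤ.+ x ℤ.* form rs x y
    ≡⟨ lemma₁ r (y ℤ.^ k) (y ℤ.^ length dt) x (form rs x y) (form dt x y) ⟩
  r ℤ.* y ℤ.^ k ℤ.* form (1ℤ ∷ dt) x y ℤ.+ x ℤ.* (form rs x y ℤ.+ ℤ.- (r ℤ.* (y ℤ.^ k ℤ.* form dt x y)))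
    ≡⟨ cong (λ z → r ℤ.* y ℤ.^ k ℤ.* form (1ℤ ∷ dt) x y ℤ.+ x ℤ.* z) (trans (sym (form-subFront r rs dt k x y eq′)) (form-divHi k rs′ dt x y eq″)) ⟩
  r ℤ.* y ℤ.^ k ℤ.* form (1ℤ ∷ dt) x y
    ℤ.+ x ℤ.* (form (divHi k rs′ dt) x y ℤ.* form (1ℤ ∷ dt) x y ℤ.+ x ℤ.^ k ℤ.* form (remHi k rs′ dt) x y)
    ≡⟨ lemma₂ r (y ℤ.^ k) (form (1ℤ ∷ dt) x y) x (form (divHi k rs′ dt) x y) (x ℤ.^ k) (form (remHi k rs′ dt) x y) ⟩
  (r ℤ.* y ℤ.^ k ℤ.+ x ℤ.* form (divHi k rs′ dt) x y) ℤ.* form (1ℤ ∷ dt) x y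
    ℤ.+ x ℤ.* x ℤ.^ k ℤ.* form (remHi k rs′ dt) x y
    ≡⟨ cong (λ i → (r ℤ.* y ℤ.^ i ℤ.+ x ℤ.* form (divHi k rs′ dt) x y) ℤ.* form (1ℤ ∷ dt) x y
                   ℤ.+ x ℤ.* x ℤ.^ k ℤ.* form (remHi k rs′ dt) x y) (length-divHi k rs′ dt eq″) ⟨
  form (divHi (suc k) (r ∷ rs) dt) x y ℤ.* form (1ℤ ∷ dt) x y ℤ.+ x ℤ.^ suc k ℤ.* form (remHi k rs′ dt) x y ∎
  where
  open ≡-Reasoning
  rs′ : List ℤ
  rs′ = subFront r rs dt
  eq′ : length rs ≡ k + length dt
  eq′ = suc-injective eq
  eq″ : length rs′ ≡ k + length dt
  eq″ = trans (length-subFront r rs dt) eq′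
  lemma₁ : ∀ r u v x f g → r ℤ.* (u ℤ.* v) ℤ.+ x ℤ.* f
    ≡ r ℤ.* u ℤ.* (1ℤ ℤ.* v ℤ.+ x ℤ.* g) ℤ.+ x ℤ.* (f ℤ.+ ℤ.- (r ℤ.* (u ℤ.* g)))
  lemma₁ = ℤ-Solver.solve-∀
  lemma₂ : ∀ r u f x q v s → r ℤ.* u ℤ.* f ℤ.+ x ℤ.* (q ℤ.* f ℤ.+ v ℤ.* s)
    ≡ (r ℤ.* u ℤ.+ x ℤ.* q) ℤ.* f ℤ.+ x ℤ.* v ℤ.* s
  lemma₂ = ℤ-Solver.solve-∀

∣i^n∣≡∣i∣^n : ∀ i n → ∣ i ℤ.^ n ∣ ≡ ∣ i ∣ ^ n
∣i^n∣≡∣i∣^n i zero    = refl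
∣i^n∣≡∣i∣^n i (suc n) = trans (ℤ.abs-* i (i ℤ.^ n)) (cong (∣ i ∣ *_) (∣i^n∣≡∣i∣^n i n))

height : List ℤ → ℕ
height cs = sum (map ∣_∣ cs)

-- As a polynomial in `a` the value has degree below `length cs`. The factor `a` on the left avoids
-- the exponent `length cs - 1`, which makes no sense for the empty list.
∣form∣-bound : ∀ cs a .{{_ : NonZero a}} →
               a * ∣ form cs 1ℤ (+ a) ∣ ≤ height cs * a ^ length cs
∣form∣-bound []       a = ≤-reflexive (*-zeroʳ a)
∣form∣-bound (c ∷ cs) a = begin
  a * ∣ c ℤ.* (+ a) ℤ.^ n ℤ.+ 1ℤ ℤ.* f ∣
    ≤⟨ *-monoʳ-≤ a (ℤ.∣i+j∣≤∣i∣+∣j∣ (c ℤ.* (+ a) ℤ.^ n) (1ℤ ℤ.* f)) ⟩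
  a * (∣ c ℤ.* (+ a) ℤ.^ n ∣ + ∣ 1ℤ ℤ.* f ∣)
    ≡⟨ cong₂ (λ u v → a * (u + v)) (trans (ℤ.abs-* c ((+ a) ℤ.^ n)) (cong (∣ c ∣ *_) (∣i^n∣≡∣i∣^n (+ a) n))) (cong ∣_∣ (ℤ.*-identityˡ f)) ⟩
  a * (∣ c ∣ * a ^ n + ∣ f ∣)
    ≡⟨ *-distribˡ-+ a _ _ ⟩
  a * (∣ c ∣ * a ^ n) + a * ∣ f ∣
    ≤⟨ +-monoʳ-≤ (a * (∣ c ∣ * a ^ n)) (∣form∣-bound cs a) ⟩
  a * (∣ c ∣ * a ^ n) + height cs * a ^ n
    ≤⟨ +-monoʳ-≤ (a * (∣ c ∣ * a ^ n)) (*-monoʳ-≤ (height cs) (m≤n*m (a ^ n) a)) ⟩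
  a * (∣ c ∣ * a ^ n) + height cs * (a * a ^ n)
    ≡⟨ cong (_+ height cs * (a * a ^ n)) (trans (sym (*-assoc a _ _)) (trans (cong (_* a ^ n) (*-comm a ∣ c ∣)) (*-assoc ∣ c ∣ a _))) ⟩
  ∣ c ∣ * (a * a ^ n) + height cs * (a * a ^ n)
    ≡⟨ *-distribʳ-+ (a * a ^ n) ∣ c ∣ (height cs) ⟨
  (∣ c ∣ + height cs) * (a * a ^ n) ∎
  where
  open ≤-Reasoning
  n = length cs
  f = form cs 1ℤ (+ a)

-- Exactness of the division defining the cyclotomic polynomials

-- At y = 1 the constant coefficient is a multiple of every large a, hence 0; then a can be
-- cancelled and the tail vanishes in turn.
form-vanishes : ∀ cs A → (∀ a → A ≤ a → form cs (+ a) 1ℤ ≡ 0ℤ) → ∀ x y → form cs x y ≡ 0ℤ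
form-vanishes []       A h x y = refl
form-vanishes (c ∷ cs) A h x y = begin
  c ℤ.* y ℤ.^ length cs ℤ.+ x ℤ.* form cs x y
    ≡⟨ cong₂ (λ u v → u ℤ.* y ℤ.^ length cs ℤ.+ x ℤ.* v) c≡0 (form-vanishes cs (suc A) rest x y) ⟩
  0ℤ ℤ.* y ℤ.^ length cs ℤ.+ x ℤ.* 0ℤ
    ≡⟨ lemma (y ℤ.^ length cs) x ⟩
  0ℤ ∎
  where
  open ≡-Reasoning
  lemma : ∀ u x → 0ℤ ℤ.* u ℤ.+ x ℤ.* 0ℤ ≡ 0ℤ
  lemma = ℤ-Solver.solve-∀
  value : ∀ a → A ≤ a → c ≡ ℤ.- (+ a ℤ.* form cs (+ a) 1ℤ)
  value a A≤a = begin
    c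
      ≡⟨ lemma₁ c (+ a ℤ.* f) ⟩
    (c ℤ.* 1ℤ ℤ.+ + a ℤ.* f) ℤ.+ ℤ.- (+ a ℤ.* f)
      ≡⟨ cong (λ u → (c ℤ.* u ℤ.+ + a ℤ.* f) ℤ.+ ℤ.- (+ a ℤ.* f)) (ℤ.^-zeroˡ (length cs)) ⟨
    form (c ∷ cs) (+ a) 1ℤ ℤ.+ ℤ.- (+ a ℤ.* f)
      ≡⟨ cong (ℤ._+ ℤ.- (+ a ℤ.* f)) (h a A≤a) ⟩
    0ℤ ℤ.+ ℤ.- (+ a ℤ.* f)
      ≡⟨ ℤ.+-identityˡ _ ⟩
    ℤ.- (+ a ℤ.* f) ∎
    where
    f = form cs (+ a) 1ℤ
    lemma₁ : ∀ c v → c ≡ (c ℤ.* 1ℤ ℤ.+ v) ℤ.+ ℤ.- v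
    lemma₁ = ℤ-Solver.solve-∀
  ∣c∣ : ∀ a → A ≤ a → ∣ c ∣ ≡ a * ∣ form cs (+ a) 1ℤ ∣
  ∣c∣ a A≤a = trans (cong ∣_∣ (value a A≤a)) (trans (ℤ.∣-i∣≡∣i∣ (+ a ℤ.* form cs (+ a) 1ℤ)) (ℤ.abs-* (+ a) _))
  small-multiple : ∀ m a k → m < a → m ≡ a * k → m ≡ 0
  small-multiple m a zero    m<a eq = trans eq (*-zeroʳ a)
  small-multiple m a (suc k) m<a eq = contradiction (subst (a ≤_) (sym eq) (m≤m*n a (suc k))) (<⇒≱ m<a)
  c≡0 : c ≡ 0ℤ
  c≡0 = ℤ.∣i∣≡0⇒i≡0 (small-multiple ∣ c ∣ (suc (A + ∣ c ∣)) _ (s≤s (m≤n+m ∣ c ∣ A))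
                       (∣c∣ (suc (A + ∣ c ∣)) (m≤n⇒m≤1+n (m≤m+n A ∣ c ∣))))
  rest : ∀ a → suc A ≤ a → form cs (+ a) 1ℤ ≡ 0ℤ
  rest (suc a) A<a with m*n≡0⇒m≡0∨n≡0 (suc a) (trans (sym (∣c∣ (suc a) (<⇒≤ A<a))) (cong ∣_∣ c≡0))
  ... | inj₂ ∣f∣≡0 = ℤ.∣i∣≡0⇒i≡0 ∣f∣≡0

-- For large a the monic value exceeds the value of any form of smaller degree.
multiple-of-monic-vanishes : ∀ dt r → length r ≡ length dt →
  (∀ a → 2 ≤ a → form (1ℤ ∷ dt) 1ℤ (+ a) ℤ.∣ form r 1ℤ (+ a)) → ∀ x y → form r x y ≡ 0ℤ
multiple-of-monic-vanishes dt r len div x y =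
  trans (sym (form-reverse r y x)) (form-vanishes (reverse r) (2 + (height r + height dt)) large y x)
  where
  large : ∀ a → 2 + (height r + height dt) ≤ a → form (reverse r) (+ a) 1ℤ ≡ 0ℤ
  large a@(suc _) a≥ = trans (form-reverse r (+ a) 1ℤ) (zero-value (div a (≤-trans (s≤s (s≤s z≤n)) a≥)))
    where
    e = length dt
    D = form (1ℤ ∷ dt) 1ℤ (+ a)
    zero-value : D ℤ.∣ form r 1ℤ (+ a) → form r 1ℤ (+ a) ≡ 0ℤ
    zero-value (ℤ.divides s eq) with ∣ s ∣ ≟ 0
    ... | yes s≡0 = trans eq (trans (cong (ℤ._* D) (ℤ.∣i∣≡0⇒i≡0 {s} s≡0)) (ℤ.*-zeroˡ D))
    -- A non-zero cofactor makes |D| at most the value of r, of order a^(e-1). But a^e is at most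
    -- |D| plus the lower terms of the divisor, so a would not exceed the sum of the two heights.
    ... | no s≢0  = contradiction too-big (<⇒≱ bound)
      where
      open ≤-Reasoning
      instance
        s-nonZero : NonZero ∣ s ∣
        s-nonZero = ≢-nonZero s≢0
        a^e-nonZero : NonZero (a ^ e)
        a^e-nonZero = m^n≢0 a e
      bound : (height r + height dt) * a ^ e < a * a ^ e
      bound = *-monoˡ-< (a ^ e) (<-≤-trans (n<1+n _) (≤-trans (n≤1+n _) a≥))
      a*D≤ : a * ∣ D ∣ ≤ height r * a ^ e
      a*D≤ = begin
        a * ∣ D ∣                ≤⟨ *-monoʳ-≤ a (m≤n*m ∣ D ∣ ∣ s ∣) ⟩
        a * (∣ s ∣ * ∣ D ∣)      ≡⟨ cong (a *_) (trans (cong ∣_∣ eq) (ℤ.abs-* s D)) ⟨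
        a * ∣ form r 1ℤ (+ a) ∣  ≤⟨ ∣form∣-bound r a ⟩
        height r * a ^ length r  ≡⟨ cong (λ k → height r * a ^ k) len ⟩
        height r * a ^ e         ∎
      a^e≤ : a ^ e ≤ ∣ D ∣ + ∣ form dt 1ℤ (+ a) ∣
      a^e≤ = begin
        a ^ e                             ≡⟨ ∣i^n∣≡∣i∣^n (+ a) e ⟨
        ∣ (+ a) ℤ.^ e ∣                   ≡⟨ cong ∣_∣ (lemma ((+ a) ℤ.^ e) (form dt 1ℤ (+ a))) ⟩
        ∣ D ℤ.- form dt 1ℤ (+ a) ∣        ≤⟨ ℤ.∣i-j∣≤∣i∣+∣j∣ D (form dt 1ℤ (+ a)) ⟩
        ∣ D ∣ + ∣ form dt 1ℤ (+ a) ∣      ∎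
        where
        lemma : ∀ u f → u ≡ (1ℤ ℤ.* u ℤ.+ 1ℤ ℤ.* f) ℤ.+ ℤ.- f
        lemma = ℤ-Solver.solve-∀
      too-big : a * a ^ e ≤ (height r + height dt) * a ^ e
      too-big = begin
        a * a ^ e                                    ≤⟨ *-monoʳ-≤ a a^e≤ ⟩
        a * (∣ D ∣ + ∣ form dt 1ℤ (+ a) ∣)           ≡⟨ *-distribˡ-+ a ∣ D ∣ _ ⟩
        a * ∣ D ∣ + a * ∣ form dt 1ℤ (+ a) ∣         ≤⟨ +-mono-≤ a*D≤ (∣form∣-bound dt a) ⟩
        height r * a ^ e + height dt * a ^ e         ≡⟨ *-distribʳ-+ (a ^ e) (height r) (height dt) ⟨
        (height r + height dt) * a ^ e               ∎

module _ {k e p d} (mp : Monic (k + e) p) (md : Monic e d) where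

  private
    rs = reverse (lowerCoeffs mp)
    dt = reverse (lowerCoeffs md)

    length-p : length (reverse p) ≡ suc k + length dt
    length-p = trans (length-reverse p) (trans (length-monic mp)
                 (cong (λ i → suc (k + i)) (sym (trans (length-reverse (lowerCoeffs md)) (length-lowerCoeffs md)))))

    divMonic-unfold : divMonic p d ≡ reverse (divHi (suc k) (reverse p) dt)
    divMonic-unfold rewrite reverse-monic md | length-monic mp | length-monic md | +-∸-assoc (suc k) (≤-refl {e}) | n∸n≡0 e | +-identityʳ k = refl

  divMonic-monic : Monic k (divMonic p d)
  divMonic-monic = monic (reverse q)
    (trans (length-reverse q) (length-divHi k (subFront 1ℤ rs dt) dt (trans (length-subFront 1ℤ rs dt)
      (suc-injective (trans (sym (cong length (reverse-monic mp))) length-p)))))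
    (trans divMonic-unfold (trans (cong (λ l → reverse (divHi (suc k) l dt)) (reverse-monic mp)) (unfold-reverse 1ℤ q)))
    where
    q = divHi k (subFront 1ℤ rs dt) dt

  -- Divisibility of values is enough: d then divides the value of the remainder at every a ≥ 2, and
  -- the remainder has smaller degree, so it vanishes as a form.
  divMonic-exact : (∀ a → 2 ≤ a → form d (+ a) 1ℤ ℤ.∣ form p (+ a) 1ℤ) →
                   ∀ x y → form p x y ≡ form (divMonic p d) x y ℤ.* form d x y
  divMonic-exact div x y = begin
    form p x y              ≡⟨ form-reverse p y x ⟨
    form (reverse p) y x    ≡⟨ form-divHi (suc k) (reverse p) dt y x length-p ⟩
    form q y x ℤ.* form (1ℤ ∷ dt) y x ℤ.+ y ℤ.^ suc k ℤ.* form r y x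
                            ≡⟨ cong₂ (λ u v → u ℤ.+ y ℤ.^ suc k ℤ.* v) (cong₂ ℤ._*_ q-form (d-form x y)) (r-vanishes y x) ⟩
    form (divMonic p d) x y ℤ.* form d x y ℤ.+ y ℤ.^ suc k ℤ.* 0ℤ
                            ≡⟨ lemma (form (divMonic p d) x y ℤ.* form d x y) (y ℤ.^ suc k) ⟩
    form (divMonic p d) x y ℤ.* form d x y ∎
    where
    open ≡-Reasoning
    q r : List ℤ
    q = divHi (suc k) (reverse p) dt
    r = remHi (suc k) (reverse p) dt
    lemma : ∀ u v → u ℤ.+ v ℤ.* 0ℤ ≡ u
    lemma = ℤ-Solver.solve-∀
    q-form : form q y x ≡ form (divMonic p d) x y
    q-form = sym (trans (cong (λ l → form l x y) divMonic-unfold) (form-reverse q x y))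
    d-form : ∀ x y → form (1ℤ ∷ dt) y x ≡ form d x y
    d-form x y = trans (cong (λ l → form l y x) (sym (reverse-monic md))) (form-reverse d y x)
    r-vanishes : ∀ x y → form r x y ≡ 0ℤ
    r-vanishes = multiple-of-monic-vanishes dt r (length-remHi (suc k) (reverse p) dt length-p) λ a 2≤a →
      subst (ℤ._∣ form r 1ℤ (+ a)) (sym (d-form (+ a) 1ℤ))
        (ℤ.∣m+n∣m⇒∣n (subst (form d (+ a) 1ℤ ℤ.∣_) (expand a) (div a 2≤a)) (ℤ.∣n⇒∣m*n (form q 1ℤ (+ a)) ℤ.∣-refl))
      where
      expand : ∀ a → form p (+ a) 1ℤ ≡ form q 1ℤ (+ a) ℤ.* form d (+ a) 1ℤ ℤ.+ form r 1ℤ (+ a)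
      expand a = trans (sym (form-reverse p 1ℤ (+ a)))
        (trans (form-divHi (suc k) (reverse p) dt 1ℤ (+ a) length-p)
          (cong₂ (λ u v → form q 1ℤ (+ a) ℤ.* u ℤ.+ v) (d-form (+ a) 1ℤ)
            (trans (cong (ℤ._* form r 1ℤ (+ a)) (ℤ.^-zeroˡ (suc k))) (ℤ.*-identityˡ _))))

xn-1-monic : ∀ n .{{_ : NonZero n}} → Monic n (xn-1 n)
xn-1-monic (suc k) = monic (-[1+ 0 ] ∷ replicate k 0ℤ) (cong suc (length-replicate k)) refl

form-xn-1 : ∀ n .{{_ : NonZero n}} x y → form (xn-1 n) x y ≡ x ℤ.^ n ℤ.- y ℤ.^ n
form-xn-1 (suc k) x y = begin
  form ((-[1+ 0 ] ∷ replicate k 0ℤ) ++ 1ℤ ∷ []) x y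
    ≡⟨ form-∷ʳ (-[1+ 0 ] ∷ replicate k 0ℤ) 1ℤ x y ⟩
  y ℤ.* (ℤ.- 1ℤ ℤ.* y ℤ.^ length (replicate k 0ℤ) ℤ.+ x ℤ.* form (replicate k 0ℤ) x y)
    ℤ.+ 1ℤ ℤ.* (x ℤ.* x ℤ.^ length (replicate k 0ℤ))
    ≡⟨ cong₂ (λ i z → y ℤ.* (ℤ.- 1ℤ ℤ.* y ℤ.^ i ℤ.+ x ℤ.* z) ℤ.+ 1ℤ ℤ.* (x ℤ.* x ℤ.^ i))
         (length-replicate k) (form-0 k) ⟩
  y ℤ.* (ℤ.- 1ℤ ℤ.* y ℤ.^ k ℤ.+ x ℤ.* 0ℤ) ℤ.+ 1ℤ ℤ.* (x ℤ.* x ℤ.^ k)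
    ≡⟨ lemma x y (x ℤ.^ k) (y ℤ.^ k) ⟩
  x ℤ.* x ℤ.^ k ℤ.+ ℤ.- (y ℤ.* y ℤ.^ k) ∎
  where
  open ≡-Reasoning
  form-0 : ∀ k → form (replicate k 0ℤ) x y ≡ 0ℤ
  form-0 zero    = refl
  form-0 (suc k) rewrite form-0 k | ℤ.*-zeroʳ x | ℤ.*-zeroˡ (y ℤ.^ length (replicate k 0ℤ)) = refl
  lemma : ∀ x y u v → y ℤ.* (ℤ.- 1ℤ ℤ.* v ℤ.+ x ℤ.* 0ℤ) ℤ.+ 1ℤ ℤ.* (x ℤ.* u) ≡ x ℤ.* u ℤ.+ ℤ.- (y ℤ.* v)
  lemma = ℤ-Solver.solve-∀

-- Strong divisibility sequences

open module Prods = Products ℤ._*_ 1ℤ ℤ.*-1-isCommutativeMonoid using (∏; ∏-divisors; when)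

*-mono-∣ : ∀ {i j k l} → i ℤ.∣ j → k ℤ.∣ l → i ℤ.* k ℤ.∣ j ℤ.* l
*-mono-∣ {i} {j} {k} {l} i∣j k∣l = ℤ.∣-trans (ℤ.*-monoʳ-∣ i k∣l) (ℤ.*-monoˡ-∣ l i∣j)

∏-mono-∣ : ∀ {f g} n → (∀ i → f i ℤ.∣ g i) → ∏ f n ℤ.∣ ∏ g n
∏-mono-∣ zero    f∣g = ℤ.∣-refl
∏-mono-∣ (suc n) f∣g = *-mono-∣ (∏-mono-∣ n f∣g) (f∣g (suc n))

∏-≤-∣ : ∀ f {m n} → m ≤ n → ∏ f m ℤ.∣ ∏ f n
∏-≤-∣ f {m} {n} m≤n = ℤ.divides (∏ (λ i → f (m + i)) (n ∸ m))
  (trans (cong (∏ f) (sym (m+[n∸m]≡n m≤n))) (trans (Prods.∏-+ f m (n ∸ m)) (ℤ.*-comm (∏ f m) _)))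

-- (1 - β c)(1 - γ c) = 1 - (β + γ - β γ c) c, so the factors found for the single d multiply to one
-- factor of the same form.
uniform-multiplier : ∀ (u : ℕ → ℤ) Q c K →
  (∀ d → 1 ≤ d → d ≤ K → ∃ λ β → u d ℤ.∣ Q ℤ.* (1ℤ ℤ.+ ℤ.- (β ℤ.* c))) →
  ∃ λ β → ∀ d → 1 ≤ d → d ≤ K → u d ℤ.∣ Q ℤ.* (1ℤ ℤ.+ ℤ.- (β ℤ.* c))
uniform-multiplier u Q c zero    single = 0ℤ , λ d 1≤d d≤0 → contradiction (≤-trans 1≤d d≤0) λ ()
uniform-multiplier u Q c (suc K) single
  with uniform-multiplier u Q c K (λ d 1≤d d≤K → single d 1≤d (m≤n⇒m≤1+n d≤K)) | single (suc K) (s≤s z≤n) ≤-refl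
... | β , all | γ , last = β ℤ.+ γ ℤ.+ ℤ.- (β ℤ.* γ ℤ.* c) , both
  where
  factorˡ : ∀ Q β γ c → Q ℤ.* (1ℤ ℤ.+ ℤ.- (β ℤ.* c)) ℤ.* (1ℤ ℤ.+ ℤ.- (γ ℤ.* c))
                      ≡ Q ℤ.* (1ℤ ℤ.+ ℤ.- ((β ℤ.+ γ ℤ.+ ℤ.- (β ℤ.* γ ℤ.* c)) ℤ.* c))
  factorˡ = ℤ-Solver.solve-∀
  factorʳ : ∀ Q β γ c → Q ℤ.* (1ℤ ℤ.+ ℤ.- (γ ℤ.* c)) ℤ.* (1ℤ ℤ.+ ℤ.- (β ℤ.* c))
                      ≡ Q ℤ.* (1ℤ ℤ.+ ℤ.- ((β ℤ.+ γ ℤ.+ ℤ.- (β ℤ.* γ ℤ.* c)) ℤ.* c))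
  factorʳ = ℤ-Solver.solve-∀
  both : ∀ d → 1 ≤ d → d ≤ suc K → u d ℤ.∣ Q ℤ.* (1ℤ ℤ.+ ℤ.- ((β ℤ.+ γ ℤ.+ ℤ.- (β ℤ.* γ ℤ.* c)) ℤ.* c))
  both d 1≤d d≤sK with d ≟ suc K
  ... | yes refl = subst (u d ℤ.∣_) (factorʳ Q β γ c) (ℤ.∣m⇒∣m*n _ last)
  ... | no d≢sK  = subst (u d ℤ.∣_) (factorˡ Q β γ c) (ℤ.∣m⇒∣m*n _ (all d 1≤d (≤-pred (≤∧≢⇒< d≤sK d≢sK))))

-- With Q = α P + β Q c, expand Q N = α P N + β Q c N and replace N by t Q c in the first term and
-- by s P in the second. Both become multiples of Q P c, and Q is cancelled.
*-∣-common-multiple : ∀ {P Q c N} → Q ≢ 0ℤ → P ℤ.∣ N → Q ℤ.* c ℤ.∣ N →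
  ∀ β → P ℤ.∣ Q ℤ.* (1ℤ ℤ.+ ℤ.- (β ℤ.* c)) → P ℤ.* c ℤ.∣ N
*-∣-common-multiple {P} {Q} {c} {N} Q≢0 (ℤ.divides s N≡sP) (ℤ.divides t N≡tQc) β (ℤ.divides α Q[1-βc]≡αP) =
  ℤ.divides (α ℤ.* t ℤ.+ β ℤ.* s) (ℤ.*-cancelˡ-≡ Q _ _ {{ℤ.≢-nonZero Q≢0}} (begin
    Q ℤ.* N
      ≡⟨ lemma₁ Q N β c ⟩
    Q ℤ.* (1ℤ ℤ.+ ℤ.- (β ℤ.* c)) ℤ.* N ℤ.+ Q ℤ.* (β ℤ.* c) ℤ.* N
      ≡⟨ cong₂ ℤ._+_ (cong₂ ℤ._*_ Q[1-βc]≡αP N≡tQc) (cong (Q ℤ.* (β ℤ.* c) ℤ.*_) N≡sP) ⟩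
    α ℤ.* P ℤ.* (t ℤ.* (Q ℤ.* c)) ℤ.+ Q ℤ.* (β ℤ.* c) ℤ.* (s ℤ.* P)
      ≡⟨ lemma₂ α P t Q c β s ⟩
    Q ℤ.* ((α ℤ.* t ℤ.+ β ℤ.* s) ℤ.* (P ℤ.* c)) ∎))
  where
  open ≡-Reasoning
  lemma₁ : ∀ Q N β c → Q ℤ.* N ≡ Q ℤ.* (1ℤ ℤ.+ ℤ.- (β ℤ.* c)) ℤ.* N ℤ.+ Q ℤ.* (β ℤ.* c) ℤ.* N
  lemma₁ = ℤ-Solver.solve-∀
  lemma₂ : ∀ α P t Q c β s → α ℤ.* P ℤ.* (t ℤ.* (Q ℤ.* c)) ℤ.+ Q ℤ.* (β ℤ.* c) ℤ.* (s ℤ.* P)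
                           ≡ Q ℤ.* ((α ℤ.* t ℤ.+ β ℤ.* s) ℤ.* (P ℤ.* c))
  lemma₂ = ℤ-Solver.solve-∀

module StrongDivisibility (u c : ℕ → ℤ)
  (bézout : ∀ i j → 1 ≤ i → 1 ≤ j → ∃ λ α → ∃ λ β → α ℤ.* u i ℤ.+ β ℤ.* u j ≡ u (gcd i j))
  (u≢0 : ∀ i → 1 ≤ i → u i ≢ 0ℤ) where

  -- Write u j = Q (c j).  For d < j the ideal (u d , u j) contains Q, hence u d divides
  -- Q (1 - β c j) for some β, which can be chosen the same for all d < j; so the product P
  -- of the earlier c d divides it too.  Then Q ∈ (P , u j), which forces P (c j) ∣ N.
  ∏-∣-common-multiple : ∀ K → (∀ k → 1 ≤ k → k ≤ K → ∏-divisors c k ≡ u k) → ∀ n N →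
    (∀ d → 1 ≤ d → d ≤ K → d ∣ n → u d ℤ.∣ N) → ∏ (λ d → when (d ∣? n) (c d)) K ℤ.∣ N
  ∏-∣-common-multiple zero    fac n N h = ℤ.divides N (sym (ℤ.*-identityʳ N))
  ∏-∣-common-multiple (suc K) fac n N h with suc K ∣? n
  ... | no _    = subst (ℤ._∣ N) (sym (ℤ.*-identityʳ _)) (∏-∣-common-multiple K (λ k 1≤k k≤K → fac k 1≤k (m≤n⇒m≤1+n k≤K)) n N
                    (λ d 1≤d d≤K → h d 1≤d (m≤n⇒m≤1+n d≤K)))
  ... | yes j∣n = *-∣-common-multiple Q≢0 P∣N (subst (ℤ._∣ N) (sym Qc≡u) (h (suc K) (s≤s z≤n) ≤-refl j∣n)) β P∣Q[1-βc]
    where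
    j = suc K
    P = ∏ (λ d → when (d ∣? n) (c d)) K
    Q = ∏ (λ d → when (d ∣? j) (c d)) K
    earlier : ∀ n N → (∀ d → 1 ≤ d → d ≤ K → d ∣ n → u d ℤ.∣ N) → ∏ (λ d → when (d ∣? n) (c d)) K ℤ.∣ N
    earlier = ∏-∣-common-multiple K (λ k 1≤k k≤K → fac k 1≤k (m≤n⇒m≤1+n k≤K))
    P∣N : P ℤ.∣ N
    P∣N = earlier n N (λ d 1≤d d≤K → h d 1≤d (m≤n⇒m≤1+n d≤K))
    Qc≡u : Q ℤ.* c j ≡ u j
    Qc≡u = trans (cong (Q ℤ.*_) (sym (Prods.when-yes (j ∣? j) ∣-refl))) (fac j (s≤s z≤n) ≤-refl)
    Q≢0 : Q ≢ 0ℤ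
    Q≢0 Q≡0 = u≢0 j (s≤s z≤n) (trans (sym Qc≡u) (trans (cong (ℤ._* c j) Q≡0) (ℤ.*-zeroˡ (c j))))
    -- As d < j, the gcd is a proper divisor of j. Its divisors are among those collected in Q, and
    -- their product is `u (gcd d j)`.
    u-gcd∣Q : ∀ d → 1 ≤ d → d ≤ K → u (gcd d j) ℤ.∣ Q
    u-gcd∣Q d 1≤d d≤K = subst (ℤ._∣ Q) (fac g 1≤g (m≤n⇒m≤1+n g≤K))
      (ℤ.∣-trans (∏-mono-∣ g pointwise) (∏-≤-∣ (λ d → when (d ∣? j) (c d)) g≤K))
      where
      g = gcd d j
      g≤K : g ≤ K
      g≤K = ≤-trans (∣⇒≤ {{>-nonZero 1≤d}} (gcd[m,n]∣m d j)) d≤K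
      1≤g : 1 ≤ g
      1≤g = n≢0⇒n>0 λ g≡0 → 1+n≢0 (0∣⇒≡0 (subst (_∣ j) g≡0 (gcd[m,n]∣n d j)))
      pointwise : ∀ i → when (i ∣? g) (c i) ℤ.∣ when (i ∣? j) (c i)
      pointwise i with i ∣? g
      ... | yes i∣g = subst (c i ℤ.∣_) (sym (Prods.when-yes (i ∣? j) (∣-trans i∣g (gcd[m,n]∣n d j)))) ℤ.∣-refl
      ... | no _    = ℤ.divides (when (i ∣? j) (c i)) (sym (ℤ.*-identityʳ _))
    single : ∀ d → 1 ≤ d → d ≤ K → ∃ λ β → u d ℤ.∣ Q ℤ.* (1ℤ ℤ.+ ℤ.- (β ℤ.* c j))
    single d 1≤d d≤K with bézout d j 1≤d (s≤s z≤n) | u-gcd∣Q d 1≤d d≤K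
    ... | α , β , eq | ℤ.divides s Q≡s*u = s ℤ.* β , ℤ.divides (s ℤ.* α) (begin
      Q ℤ.* (1ℤ ℤ.+ ℤ.- (s ℤ.* β ℤ.* c j))
        ≡⟨ lemma₁ Q s β (c j) ⟩
      Q ℤ.+ ℤ.- (s ℤ.* (β ℤ.* (Q ℤ.* c j)))
        ≡⟨ cong₂ (λ v w → v ℤ.+ ℤ.- (s ℤ.* (β ℤ.* w))) (trans Q≡s*u (cong (s ℤ.*_) (sym eq))) Qc≡u ⟩
      s ℤ.* (α ℤ.* u d ℤ.+ β ℤ.* u j) ℤ.+ ℤ.- (s ℤ.* (β ℤ.* u j))
        ≡⟨ lemma₂ s α (u d) (β ℤ.* u j) ⟩
      s ℤ.* α ℤ.* u d ∎)
      where
      open ≡-Reasoning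
      lemma₁ : ∀ Q s β c → Q ℤ.* (1ℤ ℤ.+ ℤ.- (s ℤ.* β ℤ.* c)) ≡ Q ℤ.+ ℤ.- (s ℤ.* (β ℤ.* (Q ℤ.* c)))
      lemma₁ = ℤ-Solver.solve-∀
      lemma₂ : ∀ s α v w → s ℤ.* (α ℤ.* v ℤ.+ w) ℤ.+ ℤ.- (s ℤ.* w) ≡ s ℤ.* α ℤ.* v
      lemma₂ = ℤ-Solver.solve-∀
    uniform : ∃ λ β → ∀ d → 1 ≤ d → d ≤ K → u d ℤ.∣ Q ℤ.* (1ℤ ℤ.+ ℤ.- (β ℤ.* c j))
    uniform = uniform-multiplier u Q (c j) K single
    β : ℤ
    β = proj₁ (uniform)
    P∣Q[1-βc] : P ℤ.∣ Q ℤ.* (1ℤ ℤ.+ ℤ.- (β ℤ.* c j))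
    -- The inductive statement is used a second time, with Q (1 - β c) as the common multiple in
    -- place of N.
    P∣Q[1-βc] = earlier n _ (λ d 1≤d d≤K _ → proj₂ (uniform) d 1≤d d≤K)

-- The numbers a^d - 1

module _ (a : ℕ) (2≤a : 2 ≤ a) where

  private
    u : ℕ → ℤ
    u d = (+ a) ℤ.^ d ℤ.- 1ℤ

  ^-1-+ : ∀ m n → u (m + n) ≡ (+ a) ℤ.^ m ℤ.* u n ℤ.+ u m
  ^-1-+ m n = trans (cong (ℤ._- 1ℤ) (ℤ.^-distribˡ-+-* (+ a) m n)) (lemma ((+ a) ℤ.^ m) ((+ a) ℤ.^ n))
    where
    lemma : ∀ v w → v ℤ.* w ℤ.+ ℤ.- 1ℤ ≡ v ℤ.* (w ℤ.+ ℤ.- 1ℤ) ℤ.+ (v ℤ.+ ℤ.- 1ℤ)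
    lemma = ℤ-Solver.solve-∀

  ^-1-mono-∣ : ∀ {m n} → m ∣ n → u m ℤ.∣ u n
  ^-1-mono-∣ {m} (divides k refl) = multiple k
    where
    multiple : ∀ k → u m ℤ.∣ u (k * m)
    multiple zero    = ℤ.divides 0ℤ refl
    multiple (suc k) = subst (u m ℤ.∣_) (sym (^-1-+ m (k * m)))
                         (ℤ.∣m∣n⇒∣m+n (ℤ.∣n⇒∣m*n ((+ a) ℤ.^ m) (multiple k)) ℤ.∣-refl)

  private
    -- From g + y j = x i follows u g = u (x i) - a^g u (y j), and `u (x * i)`, `u (y * j)` are
    -- multiples of `u i`, `u j`.
    combination : ∀ g i j x y → g + y * j ≡ x * i → ∃ λ α → ∃ λ β → α ℤ.* u i ℤ.+ β ℤ.* u j ≡ u g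
    combination g i j x y eq with ^-1-mono-∣ (n∣m*n x {i}) | ^-1-mono-∣ (n∣m*n y {j})
    ... | ℤ.divides s us | ℤ.divides t ut = s , ℤ.- ((+ a) ℤ.^ g ℤ.* t) , (begin
      s ℤ.* u i ℤ.+ ℤ.- ((+ a) ℤ.^ g ℤ.* t) ℤ.* u j
        ≡⟨ lemma₁ (s ℤ.* u i) ((+ a) ℤ.^ g) t (u j) ⟩
      s ℤ.* u i ℤ.+ ℤ.- ((+ a) ℤ.^ g ℤ.* (t ℤ.* u j))
        ≡⟨ cong₂ (λ v w → v ℤ.+ ℤ.- ((+ a) ℤ.^ g ℤ.* w)) (trans (cong u eq) us) ut ⟨
      u (g + y * j) ℤ.+ ℤ.- ((+ a) ℤ.^ g ℤ.* u (y * j))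
        ≡⟨ cong (ℤ._+ ℤ.- ((+ a) ℤ.^ g ℤ.* u (y * j))) (^-1-+ g (y * j)) ⟩
      (+ a) ℤ.^ g ℤ.* u (y * j) ℤ.+ u g ℤ.+ ℤ.- ((+ a) ℤ.^ g ℤ.* u (y * j))
        ≡⟨ lemma₂ ((+ a) ℤ.^ g ℤ.* u (y * j)) (u g) ⟩
      u g ∎)
      where
      open ≡-Reasoning
      lemma₁ : ∀ v w t z → v ℤ.+ ℤ.- (w ℤ.* t) ℤ.* z ≡ v ℤ.+ ℤ.- (w ℤ.* (t ℤ.* z))
      lemma₁ = ℤ-Solver.solve-∀
      lemma₂ : ∀ v w → v ℤ.+ w ℤ.+ ℤ.- v ≡ w
      lemma₂ = ℤ-Solver.solve-∀

  ^-1-bézout : ∀ i j → ∃ λ α → ∃ λ β → α ℤ.* u i ℤ.+ β ℤ.* u j ≡ u (gcd i j)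
  ^-1-bézout i j with Bézout.identity (gcd-GCD i j)
  ... | Bézout.+- x y eq = combination (gcd i j) i j x y eq
  ... | Bézout.-+ x y eq with combination (gcd i j) j i y x eq
  ...   | β , α , comb = α , β , trans (ℤ.+-comm (α ℤ.* u i) (β ℤ.* u j)) comb

  ^-1≢0 : ∀ i → 1 ≤ i → u i ≢ 0ℤ
  ^-1≢0 i 1≤i ui≡0 with m^n≡1⇒n≡0∨m≡1 a i (trans (sym (∣i^n∣≡∣i∣^n (+ a) i)) (cong ∣_∣ (ℤ.i-j≡0⇒i≡j ((+ a) ℤ.^ i) 1ℤ ui≡0)))
  ... | inj₁ i≡0 = >⇒≢ 1≤i i≡0
  ... | inj₂ a≡1 = >⇒≢ 2≤a a≡1

-- The table of cyclotomic polynomials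

table : ℕ → ℕ → List Poly
table i zero    = []
table i (suc k) = cyclo i ∷ table (suc i) k

table-∷ʳ : ∀ i k → table i (suc k) ≡ table i k ++ cyclo (i + k) ∷ []
table-∷ʳ i zero    = cong (λ j → cyclo j ∷ []) (sym (+-identityʳ i))
table-∷ʳ i (suc k) = cong (cyclo i ∷_) (trans (table-∷ʳ (suc i) k)
                       (cong (λ j → table (suc i) k ++ cyclo j ∷ []) (sym (+-suc i k))))

lastP-∷ʳ : ∀ ps p → lastP (ps ++ p ∷ []) ≡ p
lastP-∷ʳ []           p = refl
lastP-∷ʳ (_ ∷ [])     p = refl
lastP-∷ʳ (_ ∷ q ∷ ps) p = lastP-∷ʳ (q ∷ ps) p

cyclo-suc : ∀ k → cyclo (suc k) ≡ divMonic (xn-1 (suc k)) (prodDiv (suc k) 1 (cycTable k))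
cyclo-suc k = lastP-∷ʳ (cycTable k) _

-- `cycTable` grows at its end, whereas `prodDiv` consumes it from the front with a running index.
-- `table`, which may start at any index, allows induction in that direction.
cycTable-table : ∀ k → cycTable k ≡ table 1 k
cycTable-table zero    = refl
cycTable-table (suc k) = trans (cong₂ (λ t p → t ++ p ∷ []) (cycTable-table k) (sym (cyclo-suc k)))
                               (sym (table-∷ʳ 1 k))

cycloForm : ℕ → ℤ → ℤ → ℤ
cycloForm n x y = form (cyclo n) x y

-- Degree and value are found together because `form-mulP` relies on the monicity of the remaining
-- product.
prodDiv-monic : ∀ n i k → (∀ j → 1 ≤ j → j ≤ k → Monic (totient (i + j)) (cyclo (i + j))) →
  Monic (∑ (λ j → ind ((i + j) ∣? n) (totient (i + j))) k) (prodDiv n (suc i) (table (suc i) k))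
  × (∀ x y → form (prodDiv n (suc i) (table (suc i) k)) x y ≡ ∏ (λ j → when ((i + j) ∣? n) (cycloForm (i + j) x y)) k)
prodDiv-monic n i zero    h = monic [] refl refl , λ x y → lemma x
  where
  lemma : ∀ x → 1ℤ ℤ.* 1ℤ ℤ.+ x ℤ.* 0ℤ ≡ 1ℤ
  lemma = ℤ-Solver.solve-∀
prodDiv-monic n i (suc k) h = subst (λ e → Monic e poly) (sym ∑-eq) (proj₁ step) , λ x y → trans (proj₂ step x y) (sym (∏-eq x y))
  where
  poly = prodDiv n (suc i) (table (suc i) (suc k))
  rest = prodDiv n (2 + i) (table (2 + i) k)
  e′ : ℕ
  e′ = ∑ (λ j → ind ((suc i + j) ∣? n) (totient (suc i + j))) k
  v′ : ℤ → ℤ → ℤ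
  v′ x y = ∏ (λ j → when ((suc i + j) ∣? n) (cycloForm (suc i + j) x y)) k
  ih : Monic e′ rest × (∀ x y → form rest x y ≡ v′ x y)
  ih = prodDiv-monic n (suc i) k (λ j 1≤j j≤k → subst (λ m → Monic (totient m) (cyclo m)) (+-suc i j) (h (suc j) (s≤s z≤n) (s≤s j≤k)))
  head : Monic (totient (suc i)) (cyclo (suc i))
  head = subst (λ m → Monic (totient m) (cyclo m)) (+-comm i 1) (h 1 ≤-refl (s≤s z≤n))
  step : Monic (ind (suc i ∣? n) (totient (suc i)) + e′) poly
         × (∀ x y → form poly x y ≡ when (suc i ∣? n) (cycloForm (suc i) x y) ℤ.* v′ x y)
  step with suc i ∣? n
  ... | yes _ = mulP-monic head (proj₁ ih)
              , λ x y → trans (form-mulP head (proj₁ ih) x y) (cong (cycloForm (suc i) x y ℤ.*_) (proj₂ ih x y))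
  ... | no _  = proj₁ ih , λ x y → trans (proj₂ ih x y) (sym (ℤ.*-identityˡ (v′ x y)))
  ∑-eq : ∑ (λ j → ind ((i + j) ∣? n) (totient (i + j))) (suc k) ≡ ind (suc i ∣? n) (totient (suc i)) + e′
  ∑-eq = trans (Sums.∏-+ (λ j → ind ((i + j) ∣? n) (totient (i + j))) 1 k)
    (cong₂ _+_ (cong (λ m → ind (m ∣? n) (totient m)) (+-comm i 1))
               (Sums.∏-cong k (λ j _ _ → cong (λ m → ind (m ∣? n) (totient m)) (+-suc i j))))
  ∏-eq : ∀ x y → ∏ (λ j → when ((i + j) ∣? n) (cycloForm (i + j) x y)) (suc k)
               ≡ when (suc i ∣? n) (cycloForm (suc i) x y) ℤ.* v′ x y
  ∏-eq x y = trans (Prods.∏-+ (λ j → when ((i + j) ∣? n) (cycloForm (i + j) x y)) 1 k)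
    (cong₂ ℤ._*_ (trans (ℤ.*-identityˡ _) (cong (λ m → when (m ∣? n) (cycloForm m x y)) (+-comm i 1)))
                 (Prods.∏-cong k (λ j _ _ → cong (λ m → when (m ∣? n) (cycloForm m x y)) (+-suc i j))))

CyclotomicFactor : ℕ → Set
CyclotomicFactor n = Monic (totient n) (cyclo n)
                   × (∀ x y → ∏-divisors (λ d → cycloForm d x y) n ≡ x ℤ.^ n ℤ.- y ℤ.^ n)

-- Both claims go through one strong induction: the degrees of the smaller polynomials give the
-- division its shape, and their product formula makes their values at (a, 1) factors of the a^d -
-- 1, which yields exactness.
cyclo-factor : ∀ n → 1 ≤ n → CyclotomicFactor n
cyclo-factor = <-rec (λ n → 1 ≤ n → CyclotomicFactor n) step
  where
  step : ∀ n → (∀ {d} → d < n → 1 ≤ d → CyclotomicFactor d) → 1 ≤ n → CyclotomicFactor n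
  step n@(suc k) ih _ = monic-n , product-n
    where
    open ≡-Reasoning
    P = prodDiv n 1 (table 1 k)
    e : ℕ
    e = ∑ (λ d → ind (d ∣? n) (totient d)) k
    P-spec : Monic e P × (∀ x y → form P x y ≡ ∏ (λ d → when (d ∣? n) (cycloForm d x y)) k)
    P-spec = prodDiv-monic n 0 k (λ j 1≤j j≤k → proj₁ (ih (s≤s j≤k) 1≤j))
    degree : totient n + e ≡ n
    degree = begin
      totient n + e                       ≡⟨ +-comm (totient n) e ⟩
      e + totient n                       ≡⟨ cong (λ i → e + i) (Sums.when-yes (n ∣? n) ∣-refl) ⟨
      e + ind (n ∣? n) (totient n)        ≡⟨ ∑-totient n ⟩
      n                                   ∎
    cyclo-n : cyclo n ≡ divMonic (xn-1 n) P
    cyclo-n = trans (cyclo-suc k) (cong (λ t → divMonic (xn-1 n) (prodDiv n 1 t)) (cycTable-table k))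
    monic-xn-1 : Monic (totient n + e) (xn-1 n)
    monic-xn-1 = subst (λ i → Monic i (xn-1 n)) (sym degree) (xn-1-monic n)
    form-at-1 : ∀ d a → (+ a) ℤ.^ d ℤ.- 1ℤ ℤ.^ d ≡ (+ a) ℤ.^ d ℤ.- 1ℤ
    form-at-1 d a = cong (λ z → (+ a) ℤ.^ d ℤ.- z) (ℤ.^-zeroˡ d)
    divisible : ∀ a → 2 ≤ a → form P (+ a) 1ℤ ℤ.∣ form (xn-1 n) (+ a) 1ℤ
    divisible a 2≤a = subst₂ ℤ._∣_ (sym (proj₂ P-spec (+ a) 1ℤ)) (sym (trans (form-xn-1 n (+ a) 1ℤ) (form-at-1 n a)))
      (∏-∣-common-multiple k (λ d 1≤d d≤k → trans (proj₂ (ih (s≤s d≤k) 1≤d) (+ a) 1ℤ) (form-at-1 d a)) n _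
        (λ d _ _ d∣n → ^-1-mono-∣ a 2≤a d∣n))
      where
      open StrongDivisibility (λ d → (+ a) ℤ.^ d ℤ.- 1ℤ) (λ d → cycloForm d (+ a) 1ℤ)
             (λ i j _ _ → ^-1-bézout a 2≤a i j) (^-1≢0 a 2≤a)
    monic-n : Monic (totient n) (cyclo n)
    monic-n = subst (Monic (totient n)) (sym cyclo-n) (divMonic-monic monic-xn-1 (proj₁ P-spec))
    product-n : ∀ x y → ∏-divisors (λ d → cycloForm d x y) n ≡ x ℤ.^ n ℤ.- y ℤ.^ n
    product-n x y = begin
      ∏ (λ d → when (d ∣? n) (cycloForm d x y)) k ℤ.* when (n ∣? n) (cycloForm n x y)
        ≡⟨ cong₂ ℤ._*_ (sym (proj₂ P-spec x y)) (Prods.when-yes (n ∣? n) ∣-refl) ⟩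
      form P x y ℤ.* cycloForm n x y
        ≡⟨ ℤ.*-comm (form P x y) (cycloForm n x y) ⟩
      cycloForm n x y ℤ.* form P x y
        ≡⟨ cong (λ p → form p x y ℤ.* form P x y) cyclo-n ⟩
      form (divMonic (xn-1 n) P) x y ℤ.* form P x y
        ≡⟨ divMonic-exact monic-xn-1 (proj₁ P-spec) divisible x y ⟨
      form (xn-1 n) x y
        ≡⟨ form-xn-1 n x y ⟩
      x ℤ.^ n ℤ.- y ℤ.^ n ∎

Φ-cycloForm : ∀ n → 1 ≤ n → ∀ x y → Φ n x y ≡ cycloForm n x y
Φ-cycloForm n 1≤n x y = homEval-form (cyclo n) x y (length-monic (proj₁ (cyclo-factor n 1≤n)))

-- Recursion of the cyclotomic forms along primes

-- This takes the place of Möbius inversion: by strong induction the factors at proper divisors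
-- agree, and their product divides the non-zero `∏-divisors g n`, so it can be cancelled.
∏-divisors-injective : ∀ f g → (∀ n → 1 ≤ n → ∏-divisors f n ≡ ∏-divisors g n) →
  (∀ n → 1 ≤ n → ∏-divisors g n ≢ 0ℤ) → ∀ n → 1 ≤ n → f n ≡ g n
∏-divisors-injective f g f≗g g≢0 = <-rec (λ n → 1 ≤ n → f n ≡ g n) step
  where
  step : ∀ n → (∀ {d} → d < n → 1 ≤ d → f d ≡ g d) → 1 ≤ n → f n ≡ g n
  step n@(suc k) ih 1≤n = ℤ.*-cancelˡ-≡ G (f n) (g n) {{ℤ.≢-nonZero G≢0}} (begin
    G ℤ.* f n
      ≡⟨ cong₂ ℤ._*_ (Prods.∏-cong k (λ d 1≤d d≤k → cong (when (d ∣? n)) (ih (s≤s d≤k) 1≤d))) (Prods.when-yes (n ∣? n) ∣-refl) ⟨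
    ∏-divisors f n
      ≡⟨ f≗g n 1≤n ⟩
    G ℤ.* when (n ∣? n) (g n)
      ≡⟨ cong (G ℤ.*_) (Prods.when-yes (n ∣? n) ∣-refl) ⟩
    G ℤ.* g n ∎)
    where
    open ≡-Reasoning
    G : ℤ
    G = ∏ (λ d → when (d ∣? n) (g d)) k
    G≢0 : G ≢ 0ℤ
    G≢0 G≡0 = g≢0 n 1≤n (trans (cong (ℤ._* when (n ∣? n) (g n)) G≡0) (ℤ.*-zeroˡ (when (n ∣? n) (g n))))

^-injectiveˡ : ∀ a b n .{{_ : NonZero n}} → a ^ n ≡ b ^ n → a ≡ b
^-injectiveˡ a b n eq with <-cmp a b
... | tri< a<b _ _ = contradiction eq (<⇒≢ (^-monoˡ-< n a<b))
... | tri≈ _ a≡b _ = a≡b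
... | tri> _ _ b<a = contradiction (sym eq) (<⇒≢ (^-monoˡ-< n b<a))

x^n-y^n≢0 : ∀ {x y} → ∣ x ∣ ≢ ∣ y ∣ → ∀ n → 1 ≤ n → x ℤ.^ n ℤ.- y ℤ.^ n ≢ 0ℤ
x^n-y^n≢0 {x} {y} ∣x∣≢∣y∣ n 1≤n eq = ∣x∣≢∣y∣ (^-injectiveˡ ∣ x ∣ ∣ y ∣ n {{>-nonZero 1≤n}}
  (trans (sym (∣i^n∣≡∣i∣^n x n)) (trans (cong ∣_∣ (ℤ.i-j≡0⇒i≡j (x ℤ.^ n) (y ℤ.^ n) eq)) (∣i^n∣≡∣i∣^n y n))))

-- x^(n p) - y^(n p) is factored twice: over the divisors of n p at (x, y), regrouped along p, and
-- over the divisors of n at (x^p, y^p). The inequality of absolute values keeps such differences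
-- non-zero.
cycloForm-*-prime : ∀ {p} → Prime p → ∀ {x y} → ∣ x ∣ ≢ ∣ y ∣ → ∀ n → 1 ≤ n →
  cycloForm (n * p) x y ℤ.* when (¬? (p ∣? n)) (cycloForm n x y) ≡ cycloForm n (x ℤ.^ p) (y ℤ.^ p)
cycloForm-*-prime {p} pr {x} {y} ∣x∣≢∣y∣ =
  ∏-divisors-injective (λ d → cycloForm (d * p) x y ℤ.* when (¬? (p ∣? d)) (cycloForm d x y))
                       (λ d → cycloForm d (x ℤ.^ p) (y ℤ.^ p)) products nonzero
  where
  open ≡-Reasoning
  instance
    p≢0 : NonZero p
    p≢0 = prime⇒nonZero pr
  products : ∀ n → 1 ≤ n →
    ∏-divisors (λ d → cycloForm (d * p) x y ℤ.* when (¬? (p ∣? d)) (cycloForm d x y)) n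
    ≡ ∏-divisors (λ d → cycloForm d (x ℤ.^ p) (y ℤ.^ p)) n
  products n 1≤n = begin
    ∏-divisors (λ d → cycloForm (d * p) x y ℤ.* when (¬? (p ∣? d)) (cycloForm d x y)) n
      ≡⟨ Prods.∏-divisors-*-prime (λ d → cycloForm d x y) pr n {{>-nonZero 1≤n}} ⟨
    ∏-divisors (λ d → cycloForm d x y) (n * p)
      ≡⟨ proj₂ (cyclo-factor (n * p) (≤-trans 1≤n (m≤m*n n p))) x y ⟩
    x ℤ.^ (n * p) ℤ.- y ℤ.^ (n * p)
      ≡⟨ cong₂ ℤ._-_ (power x) (power y) ⟩
    (x ℤ.^ p) ℤ.^ n ℤ.- (y ℤ.^ p) ℤ.^ n
      ≡⟨ proj₂ (cyclo-factor n 1≤n) (x ℤ.^ p) (y ℤ.^ p) ⟨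
    ∏-divisors (λ d → cycloForm d (x ℤ.^ p) (y ℤ.^ p)) n ∎
    where
    power : ∀ z → z ℤ.^ (n * p) ≡ (z ℤ.^ p) ℤ.^ n
    power z = trans (cong (z ℤ.^_) (*-comm n p)) (sym (ℤ.^-*-assoc z p n))
  nonzero : ∀ n → 1 ≤ n → ∏-divisors (λ d → cycloForm d (x ℤ.^ p) (y ℤ.^ p)) n ≢ 0ℤ
  nonzero n 1≤n eq = x^n-y^n≢0 {x ℤ.^ p} {y ℤ.^ p} powers≢ n 1≤n (trans (sym (proj₂ (cyclo-factor n 1≤n) (x ℤ.^ p) (y ℤ.^ p))) eq)
    where
    powers≢ : ∣ x ℤ.^ p ∣ ≢ ∣ y ℤ.^ p ∣
    powers≢ eq = ∣x∣≢∣y∣ (^-injectiveˡ ∣ x ∣ ∣ y ∣ p (trans (sym (∣i^n∣≡∣i∣^n x p)) (trans eq (∣i^n∣≡∣i∣^n y p))))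

cycloForm-1 : ∀ x y → cycloForm 1 x y ≡ x ℤ.- y
cycloForm-1 x y = begin
  cycloForm 1 x y          ≡⟨ ℤ.*-identityˡ _ ⟨
  1ℤ ℤ.* cycloForm 1 x y   ≡⟨ proj₂ (cyclo-factor 1 ≤-refl) x y ⟩
  x ℤ.* 1ℤ ℤ.- y ℤ.* 1ℤ    ≡⟨ cong₂ ℤ._-_ (ℤ.*-identityʳ x) (ℤ.*-identityʳ y) ⟩
  x ℤ.- y                  ∎
  where open ≡-Reasoning

form-homogeneous : ∀ {e} p → length p ≡ suc e → ∀ c x y → form p (c ℤ.* x) (c ℤ.* y) ≡ c ℤ.^ e ℤ.* form p x y
form-homogeneous (b ∷ []) refl c x y = lemma b c x
  where
  lemma : ∀ b c x → b ℤ.* 1ℤ ℤ.+ c ℤ.* x ℤ.* 0ℤ ≡ 1ℤ ℤ.* (b ℤ.* 1ℤ ℤ.+ x ℤ.* 0ℤ)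
  lemma = ℤ-Solver.solve-∀
form-homogeneous (b ∷ p@(_ ∷ p′)) refl c x y = begin
  b ℤ.* (c ℤ.* y) ℤ.^ n ℤ.+ c ℤ.* x ℤ.* form p (c ℤ.* x) (c ℤ.* y)
    ≡⟨ cong₂ (λ u v → b ℤ.* u ℤ.+ c ℤ.* x ℤ.* v) (*-^ n) (form-homogeneous p refl c x y) ⟩
  b ℤ.* (c ℤ.^ n ℤ.* y ℤ.^ n) ℤ.+ c ℤ.* x ℤ.* (c ℤ.^ length p′ ℤ.* form p x y)
    ≡⟨ lemma b c (c ℤ.^ length p′) (y ℤ.^ n) x (form p x y) ⟩
  c ℤ.^ n ℤ.* form (b ∷ p) x y ∎
  where
  open ≡-Reasoning
  n = length p
  *-^ : ∀ n → (c ℤ.* y) ℤ.^ n ≡ c ℤ.^ n ℤ.* y ℤ.^ n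
  *-^ zero    = refl
  *-^ (suc n) = trans (cong (c ℤ.* y ℤ.*_) (*-^ n)) (shuffle c y (c ℤ.^ n) (y ℤ.^ n))
    where
    shuffle : ∀ c y u v → c ℤ.* y ℤ.* (u ℤ.* v) ≡ c ℤ.* u ℤ.* (y ℤ.* v)
    shuffle = ℤ-Solver.solve-∀
  lemma : ∀ b c u v x f → b ℤ.* (c ℤ.* u ℤ.* v) ℤ.+ c ℤ.* x ℤ.* (u ℤ.* f) ≡ c ℤ.* u ℤ.* (b ℤ.* v ℤ.+ x ℤ.* f)
  lemma = ℤ-Solver.solve-∀

-- Elementary inequalities

totient-*-prime-∣ : ∀ {p} → Prime p → ∀ {n} → 1 ≤ n → p ∣ n → totient (n * p) ≡ p * totient n
totient-*-prime-∣ {p} pr {n} 1≤n p∣n = begin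
  totient (n * p)                                  ≡⟨ +-identityʳ _ ⟨
  totient (n * p) + 0                              ≡⟨ cong (λ i → totient (n * p) + i) (Sums.when-no (¬? (p ∣? n)) (λ p∤n → p∤n p∣n)) ⟨
  totient (n * p) + Sums.when (¬? (p ∣? n)) (totient n) ≡⟨ totient-*-prime pr n {{>-nonZero 1≤n}} ⟩
  p * totient n                                    ∎
  where open ≡-Reasoning

totient-*-prime-∤ : ∀ {k} → Prime (suc k) → ∀ {n} → 1 ≤ n → ¬ suc k ∣ n → totient (n * suc k) ≡ k * totient n
totient-*-prime-∤ {k} pr {n} 1≤n p∤n = +-cancelˡ-≡ (totient n) _ _ (begin
  totient n + totient (n * suc k)                  ≡⟨ +-comm (totient n) _ ⟩
  totient (n * suc k) + totient n                  ≡⟨ cong (λ i → totient (n * suc k) + i) (Sums.when-yes (¬? (suc k ∣? n)) p∤n) ⟨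
  totient (n * suc k) + Sums.when (¬? (suc k ∣? n)) (totient n) ≡⟨ totient-*-prime pr n {{>-nonZero 1≤n}} ⟩
  totient n + k * totient n                        ∎)
  where open ≡-Reasoning

Odd : ℕ → Set
Odd k = ∃ λ j → k ≡ suc (j + j)

odd-1 : Odd 1
odd-1 = 0 , refl

odd-* : ∀ {m n} → Odd m → Odd n → Odd (m * n)
odd-* (i , refl) (j , refl) = i + j + (i + i) * j , lemma i j
  where
  lemma : ∀ i j → suc (i + i) * suc (j + j) ≡ suc (i + j + (i + i) * j + (i + j + (i + i) * j))
  lemma = solve-∀

[-i]^odd : ∀ {k} → Odd k → ∀ i → (ℤ.- i) ℤ.^ k ≡ ℤ.- (i ℤ.^ k)
[-i]^odd (j , refl) i = go j
  where
  base : ∀ i → ℤ.- i ℤ.* 1ℤ ≡ ℤ.- (i ℤ.* 1ℤ)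
  base = ℤ-Solver.solve-∀
  step : ∀ i w → ℤ.- i ℤ.* (ℤ.- i ℤ.* ℤ.- w) ≡ ℤ.- (i ℤ.* (i ℤ.* w))
  step = ℤ-Solver.solve-∀
  go : ∀ j → (ℤ.- i) ℤ.^ suc (j + j) ≡ ℤ.- (i ℤ.^ suc (j + j))
  go zero    = base i
  go (suc j) rewrite +-suc j j = trans (cong (λ w → ℤ.- i ℤ.* (ℤ.- i ℤ.* w)) (go j)) (step i (i ℤ.^ suc (j + j)))

[+a]^k : ∀ a k → (+ a) ℤ.^ k ≡ + (a ^ k)
[+a]^k a zero    = refl
[+a]^k a (suc k) = trans (cong ((+ a) ℤ.*_) ([+a]^k a k)) (sym (ℤ.pos-* a (a ^ k)))

∣[+m]-[+n]∣ : ∀ {m n} → n ≤ m → ∣ (+ m) ℤ.- (+ n) ∣ ≡ m ∸ n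
∣[+m]-[+n]∣ {m} {n} n≤m = cong ∣_∣ (trans (ℤ.[+m]-[+n]≡m⊖n m n) (ℤ.⊖-≥ n≤m))

-- The signs of x and z decide, and odd powers keep them, so one alternative holds for all odd k at
-- once. `quotient-within-odd` relies on this uniformity.
odd-power-difference : ∀ x z → ∣ z ∣ < ∣ x ∣ →
  (∀ {k} → Odd k → ∣ x ℤ.^ k ℤ.- z ℤ.^ k ∣ ≡ ∣ x ∣ ^ k ∸ ∣ z ∣ ^ k) ⊎
  (∀ {k} → Odd k → ∣ x ℤ.^ k ℤ.- z ℤ.^ k ∣ ≡ ∣ x ∣ ^ k + ∣ z ∣ ^ k)
odd-power-difference (+ a) (+ b) b<a = inj₁ λ {k} _ →
  trans (cong₂ (λ u v → ∣ u ℤ.- v ∣) ([+a]^k a k) ([+a]^k b k)) (∣[+m]-[+n]∣ (^-monoˡ-≤ k (<⇒≤ b<a)))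
odd-power-difference (+ a) -[1+ b ] b<a = inj₂ λ {k} odd →
  cong₂ (λ u v → ∣ u ℤ.+ v ∣) ([+a]^k a k)
    (trans (cong ℤ.-_ ([-i]^odd odd (+ suc b))) (trans (ℤ.neg-involutive _) ([+a]^k (suc b) k)))
odd-power-difference -[1+ a ] (+ b) b<a = inj₂ λ {k} odd →
  trans (cong₂ (λ u v → ∣ u ℤ.- v ∣) (trans ([-i]^odd odd (+ suc a)) (cong ℤ.-_ ([+a]^k (suc a) k))) ([+a]^k b k))
    (trans (cong ∣_∣ (sym (ℤ.neg-distrib-+ (+ (suc a ^ k)) (+ (b ^ k))))) (ℤ.∣-i∣≡∣i∣ (+ (suc a ^ k + b ^ k))))
odd-power-difference -[1+ a ] -[1+ b ] b<a = inj₁ λ {k} odd →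
  trans (cong₂ (λ u v → ∣ u ℤ.- v ∣) (trans ([-i]^odd odd (+ suc a)) (cong ℤ.-_ ([+a]^k (suc a) k)))
                                     (trans ([-i]^odd odd (+ suc b)) (cong ℤ.-_ ([+a]^k (suc b) k))))
    (trans (cong ∣_∣ (sym (ℤ.neg-distrib-+ (+ (suc a ^ k)) (ℤ.- + (suc b ^ k)))))
      (trans (ℤ.∣-i∣≡∣i∣ ((+ (suc a ^ k)) ℤ.- (+ (suc b ^ k)))) (∣[+m]-[+n]∣ (^-monoˡ-≤ k (<⇒≤ b<a)))))

-- The ratio h / a lies between 1 / l and u, stated without fractions.
Within : ℕ → ℕ → ℕ → ℕ → Set
Within l u a h = a ≤ l * h × h ≤ u * a

-- H / h is at least (A a / l) / (u a) and at most (u A a) / (a / l), so each side loses the product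
-- of both constants.
quotient-within : ∀ {l u a A G h H} .{{_ : NonZero a}} →
  Within l u a h → Within l u (A * a) H → G * h ≡ H → Within (l * u) (l * u) A G
quotient-within {l} {u} {a} {A} {G} {h} {H} (a≤ , h≤) (Aa≤ , H≤) refl =
  *-cancelʳ-≤ A _ a lower , *-cancelʳ-≤ G _ a upper
  where
  open ≤-Reasoning
  shuffle₁ : ∀ l u a G → l * (G * (u * a)) ≡ l * u * G * a
  shuffle₁ = solve-∀
  shuffle₂ : ∀ l G h → G * (l * h) ≡ l * (G * h)
  shuffle₂ = solve-∀
  shuffle₃ : ∀ l u A a → l * (u * (A * a)) ≡ l * u * A * a
  shuffle₃ = solve-∀
  lower : A * a ≤ l * u * G * a
  lower = begin
    A * a              ≤⟨ Aa≤ ⟩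
    l * (G * h)        ≤⟨ *-monoʳ-≤ l (*-monoʳ-≤ G h≤) ⟩
    l * (G * (u * a))  ≡⟨ shuffle₁ l u a G ⟩
    l * u * G * a      ∎
  upper : G * a ≤ l * u * A * a
  upper = begin
    G * a              ≤⟨ *-monoʳ-≤ G a≤ ⟩
    G * (l * h)        ≡⟨ shuffle₂ l G h ⟩
    l * (G * h)        ≤⟨ *-monoʳ-≤ l H≤ ⟩
    l * (u * (A * a))  ≡⟨ shuffle₃ l u A a ⟩
    l * u * A * a      ∎

within-weaken : ∀ {l l′ u u′ a h} → l ≤ l′ → u ≤ u′ → Within l u a h → Within l′ u′ a h
within-weaken {h = h} l≤ u≤ (a≤ , h≤) = ≤-trans a≤ (*-monoˡ-≤ h l≤) , ≤-trans h≤ (*-monoˡ-≤ _ u≤)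

-- G is the sum of the k + 1 products a^i b^(k-i), the largest being a^k. The proof works with the
-- multiplied-out relation instead of the sum.
[a^p-b^p]/[a-b] : ∀ k {a b G} → b < a → G * (a ∸ b) ≡ a ^ suc k ∸ b ^ suc k → Within 1 (suc k) (a ^ k) G
[a^p-b^p]/[a-b] k {a} {b} {G} b<a eq =
  ≤-trans (*-cancelʳ-≤ _ _ c (+-cancelʳ-≤ (a ^ k * b) _ _ lower)) (≤-reflexive (sym (*-identityˡ G))) ,
  *-cancelʳ-≤ _ _ c (+-cancelʳ-≤ (b ^ suc k) _ _ (≤-trans (≤-reflexive eq′) (upper k)))
  where
  open ≤-Reasoning
  c = a ∸ b
  instance
    c≢0 : NonZero c
    c≢0 = >-nonZero (m<n⇒0<n∸m b<a)
  c+b≡a : c + b ≡ a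
  c+b≡a = m∸n+n≡m (<⇒≤ b<a)
  eq′ : G * c + b ^ suc k ≡ a ^ suc k
  eq′ = trans (cong (_+ b ^ suc k) eq) (m∸n+n≡m (^-monoˡ-≤ (suc k) (<⇒≤ b<a)))
  lower : a ^ k * c + a ^ k * b ≤ G * c + a ^ k * b
  lower = begin
    a ^ k * c + a ^ k * b  ≡⟨ *-distribˡ-+ (a ^ k) c b ⟨
    a ^ k * (c + b)        ≡⟨ cong (a ^ k *_) c+b≡a ⟩
    a ^ k * a              ≡⟨ *-comm (a ^ k) a ⟩
    a ^ suc k              ≡⟨ eq′ ⟨
    G * c + b * b ^ k      ≤⟨ +-monoʳ-≤ (G * c) (*-monoʳ-≤ b (^-monoˡ-≤ k (<⇒≤ b<a))) ⟩
    G * c + b * a ^ k      ≡⟨ cong (λ i → G * c + i) (*-comm b (a ^ k)) ⟩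
    G * c + a ^ k * b      ∎
  upper : ∀ k → a ^ suc k ≤ suc k * a ^ k * c + b ^ suc k
  upper zero    = ≤-reflexive (trans (cong (_* 1) (sym c+b≡a)) (base c b))
    where
    base : ∀ c b → (c + b) * 1 ≡ 1 * 1 * c + b * 1
    base = solve-∀
  upper (suc k) = begin
    a * a ^ suc k                                              ≡⟨ cong (_* a ^ suc k) c+b≡a ⟨
    (c + b) * a ^ suc k                                        ≡⟨ *-distribʳ-+ (a ^ suc k) c b ⟩
    c * a ^ suc k + b * a ^ suc k                              ≤⟨ +-monoʳ-≤ (c * a ^ suc k) (*-monoʳ-≤ b (upper k)) ⟩
    c * a ^ suc k + b * (suc k * a ^ k * c + b ^ suc k)        ≡⟨ shuffle c (a ^ suc k) b (suc k * a ^ k * c) (b ^ suc k) ⟩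
    c * a ^ suc k + b * b ^ suc k + b * (suc k * a ^ k * c)    ≤⟨ +-monoʳ-≤ (c * a ^ suc k + b * b ^ suc k) (*-monoˡ-≤ (suc k * a ^ k * c) (<⇒≤ b<a)) ⟩
    c * a ^ suc k + b * b ^ suc k + a * (suc k * a ^ k * c)    ≡⟨ collect c a (a ^ k) (b * b ^ suc k) k ⟩
    suc (suc k) * a ^ suc k * c + b * b ^ suc k                ∎
    where
    shuffle : ∀ c u b v w → c * u + b * (v + w) ≡ c * u + b * w + b * v
    shuffle = solve-∀
    collect : ∀ c a u w k → c * (a * u) + w + a * (suc k * u * c) ≡ suc (suc k) * (a * u) * c + w
    collect = solve-∀

-- From b < a: the denominator is at most 2 a, and b^(k+1) ≤ b a^k bounds the numerator by a^k (a +
-- b).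
[a^p+b^p]/[a+b] : ∀ k {a b G} → b < a → G * (a + b) ≡ a ^ suc k + b ^ suc k → Within 2 1 (a ^ k) G
[a^p+b^p]/[a+b] k {a} {b} {G} b<a eq = *-cancelʳ-≤ _ _ (a + b) lower , *-cancelʳ-≤ _ _ (a + b) upper
  where
  open ≤-Reasoning
  instance
    a+b≢0 : NonZero (a + b)
    a+b≢0 = >-nonZero (≤-trans (≤-trans (s≤s z≤n) b<a) (m≤m+n a b))
  double : ∀ u a → u * (a + a) ≡ 2 * (a * u)
  double = solve-∀
  factor : ∀ a b u → a * u + b * u ≡ 1 * u * (a + b)
  factor = solve-∀
  lower : a ^ k * (a + b) ≤ 2 * G * (a + b)
  lower = begin
    a ^ k * (a + b)                ≤⟨ *-monoʳ-≤ (a ^ k) (+-monoʳ-≤ a (<⇒≤ b<a)) ⟩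
    a ^ k * (a + a)                ≡⟨ double (a ^ k) a ⟩
    2 * (a * a ^ k)                ≤⟨ *-monoʳ-≤ 2 (m≤m+n (a * a ^ k) (b ^ suc k)) ⟩
    2 * (a ^ suc k + b ^ suc k)    ≡⟨ cong (2 *_) eq ⟨
    2 * (G * (a + b))              ≡⟨ *-assoc 2 G (a + b) ⟨
    2 * G * (a + b)                ∎
  upper : G * (a + b) ≤ 1 * a ^ k * (a + b)
  upper = begin
    G * (a + b)                    ≡⟨ eq ⟩
    a * a ^ k + b * b ^ k          ≤⟨ +-monoʳ-≤ (a * a ^ k) (*-monoʳ-≤ b (^-monoˡ-≤ k (<⇒≤ b<a))) ⟩
    a * a ^ k + b * a ^ k          ≡⟨ factor a b (a ^ k) ⟩
    1 * a ^ k * (a + b)            ∎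

-- Each further exponent costs a factor 3 on the left and gains 4 on the right, so K has to be
-- checked at one exponent only.
4^-dominates : ∀ K {s t} → s ≤ t → K * 3 ^ s ≤ 4 ^ s → K * 3 ^ t ≤ 4 ^ t
4^-dominates K {s} {t} s≤t h = subst (λ i → K * 3 ^ i ≤ 4 ^ i) (m+[n∸m]≡n s≤t) (begin
  K * 3 ^ (s + d)      ≡⟨ cong (K *_) (^-distribˡ-+-* 3 s d) ⟩
  K * (3 ^ s * 3 ^ d)  ≡⟨ *-assoc K (3 ^ s) (3 ^ d) ⟨
  K * 3 ^ s * 3 ^ d    ≤⟨ *-mono-≤ h (^-monoˡ-≤ d (n≤1+n 3)) ⟩
  4 ^ s * 4 ^ d        ≡⟨ ^-distribˡ-+-* 4 s d ⟨
  4 ^ (s + d)          ∎)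
  where
  open ≤-Reasoning
  d = t ∸ s

m^[2*n]≡m^n*m^n : ∀ m n → m ^ (2 * n) ≡ m ^ n * m ^ n
m^[2*n]≡m^n*m^n m n = trans (cong (λ i → m ^ (n + i)) (+-identityʳ n)) (^-distribˡ-+-* m n n)

m*m≤ : ∀ {m n} → m ≤ n → m * m ≤ n * n
m*m≤ m≤n = *-mono-≤ m≤n m≤n

-- This is B² 3^t ≤ 4^t for B = p and t = 4 (p - 1), the smallest totient arising from a second
-- prime q ≥ 5. From p to p + 1 the square grows by at most 16/9, and 81 · 16/9 = 144 ≤ 256.
p²·81^[p-1]≤256^[p-1] : ∀ p → 3 ≤ p → p * p * 81 ^ (p ∸ 1) ≤ 256 ^ (p ∸ 1)
p²·81^[p-1]≤256^[p-1] (suc (suc (suc j))) (s≤s (s≤s (s≤s _))) = go j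
  where
  open ≤-Reasoning
  shuffle : ∀ m u → m * m * (81 * (81 * (81 * u))) ≡ 9 * (3 * m * (3 * m)) * (81 * (81 * u))
  shuffle = solve-∀
  square : ∀ m u → 9 * (4 * m * (4 * m)) * u ≡ 144 * (m * m * u)
  square = solve-∀
  3[4+j]≤4[3+j] : ∀ j → 3 * (4 + j) ≤ 4 * (3 + j)
  3[4+j]≤4[3+j] j = ≤-trans (m≤m+n _ j) (≤-reflexive (lemma j))
    where
    lemma : ∀ j → 3 * (4 + j) + j ≡ 4 * (3 + j)
    lemma = solve-∀
  go : ∀ j → (3 + j) * (3 + j) * 81 ^ (2 + j) ≤ 256 ^ (2 + j)
  go zero    = ≤ᵇ⇒≤ (3 * 3 * 81 ^ 2) (256 ^ 2) _
  go (suc j) = begin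
    (4 + j) * (4 + j) * (81 * 81 ^ (2 + j))              ≡⟨ shuffle (4 + j) (81 ^ j) ⟩
    9 * (3 * (4 + j) * (3 * (4 + j))) * 81 ^ (2 + j)     ≤⟨ *-monoˡ-≤ (81 ^ (2 + j)) (*-monoʳ-≤ 9 (m*m≤ (3[4+j]≤4[3+j] j))) ⟩
    9 * (4 * (3 + j) * (4 * (3 + j))) * 81 ^ (2 + j)     ≡⟨ square (3 + j) (81 ^ (2 + j)) ⟩
    144 * ((3 + j) * (3 + j) * 81 ^ (2 + j))             ≤⟨ *-mono-≤ (≤ᵇ⇒≤ 144 256 _) (go j) ⟩
    256 * 256 ^ (2 + j)                                  ∎

+∣i∣²≡i² : ∀ i → + (∣ i ∣ * ∣ i ∣) ≡ i ℤ.* i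
+∣i∣²≡i² (+ n)    = ℤ.pos-* n n
+∣i∣²≡i² -[1+ n ] = refl

-- 4 (x² + x z + z²) = 3 x² + (x + 2 z)². Equality at x = -2 z is the source of the constant √3/2.
quadratic-bound : ∀ x z → 3 * (∣ x ∣ * ∣ x ∣) ≤ 4 * ∣ x ℤ.* x ℤ.+ x ℤ.* z ℤ.+ z ℤ.* z ∣
quadratic-bound x z = begin
  3 * (∣ x ∣ * ∣ x ∣)
    ≤⟨ m≤m+n _ (∣ w ∣ * ∣ w ∣) ⟩
  ∣ + (3 * (∣ x ∣ * ∣ x ∣)) ℤ.+ + (∣ w ∣ * ∣ w ∣) ∣
    ≡⟨ cong₂ (λ u v → ∣ u ℤ.+ v ∣) (trans (ℤ.pos-* 3 (∣ x ∣ * ∣ x ∣)) (cong (λ u → + 3 ℤ.* u) (+∣i∣²≡i² x))) (+∣i∣²≡i² w) ⟩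
  ∣ + 3 ℤ.* (x ℤ.* x) ℤ.+ w ℤ.* w ∣
    ≡⟨ cong ∣_∣ (identity x z) ⟩
  ∣ + 4 ℤ.* (x ℤ.* x ℤ.+ x ℤ.* z ℤ.+ z ℤ.* z) ∣
    ≡⟨ ℤ.abs-* (+ 4) (x ℤ.* x ℤ.+ x ℤ.* z ℤ.+ z ℤ.* z) ⟩
  4 * ∣ x ℤ.* x ℤ.+ x ℤ.* z ℤ.+ z ℤ.* z ∣ ∎
  where
  open ≤-Reasoning
  w : ℤ
  w = x ℤ.+ + 2 ℤ.* z
  identity : ∀ x z → + 3 ℤ.* (x ℤ.* x) ℤ.+ (x ℤ.+ + 2 ℤ.* z) ℤ.* (x ℤ.+ + 2 ℤ.* z)
                   ≡ + 4 ℤ.* (x ℤ.* x ℤ.+ x ℤ.* z ℤ.+ z ℤ.* z)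
  identity = ℤ-Solver.solve-∀

quarticForm : ℤ → ℤ → ℤ
quarticForm x z = x ℤ.* x ℤ.* (x ℤ.* x) ℤ.+ x ℤ.* x ℤ.* (x ℤ.* z) ℤ.+ x ℤ.* x ℤ.* (z ℤ.* z)
                  ℤ.+ x ℤ.* z ℤ.* (z ℤ.* z) ℤ.+ z ℤ.* z ℤ.* (z ℤ.* z)

-- Completing squares twice:
-- 512 F = 288 x⁴ + 20 x⁴ + 8 (8 z² + 4 x z + x²)² + x² (16 z + 14 x)².
quartic-bound : ∀ x z → 9 * (∣ x ∣ * ∣ x ∣ * (∣ x ∣ * ∣ x ∣)) ≤ 16 * ∣ quarticForm x z ∣
quartic-bound x z = *-cancelˡ-≤ 32 (begin
  32 * (9 * X)
    ≤⟨ m≤m+n _ (20 * X + 8 * (∣ w ∣ * ∣ w ∣) + ∣ xv ∣ * ∣ xv ∣) ⟩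
  32 * (9 * X) + (20 * X + 8 * (∣ w ∣ * ∣ w ∣) + ∣ xv ∣ * ∣ xv ∣)
    ≡⟨ collect X (∣ w ∣ * ∣ w ∣) (∣ xv ∣ * ∣ xv ∣) ⟩
  ∣ + (308 * X) ℤ.+ + (8 * (∣ w ∣ * ∣ w ∣)) ℤ.+ + (∣ xv ∣ * ∣ xv ∣) ∣
    ≡⟨ cong ∣_∣ (cong₂ ℤ._+_ (cong₂ ℤ._+_ (scaled 308 X X≡) (scaled 8 (∣ w ∣ * ∣ w ∣) (+∣i∣²≡i² w))) (+∣i∣²≡i² xv)) ⟩
  ∣ + 308 ℤ.* (x ℤ.* x ℤ.* (x ℤ.* x)) ℤ.+ + 8 ℤ.* (w ℤ.* w) ℤ.+ xv ℤ.* xv ∣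
    ≡⟨ cong ∣_∣ (identity x z) ⟩
  ∣ + 512 ℤ.* quarticForm x z ∣
    ≡⟨ ℤ.abs-* (+ 512) (quarticForm x z) ⟩
  512 * ∣ quarticForm x z ∣
    ≡⟨ *-assoc 32 16 ∣ quarticForm x z ∣ ⟩
  32 * (16 * ∣ quarticForm x z ∣) ∎)
  where
  open ≤-Reasoning
  X : ℕ
  X = ∣ x ∣ * ∣ x ∣ * (∣ x ∣ * ∣ x ∣)
  w xv : ℤ
  w  = + 8 ℤ.* (z ℤ.* z) ℤ.+ + 4 ℤ.* (x ℤ.* z) ℤ.+ x ℤ.* x
  xv = x ℤ.* (+ 16 ℤ.* z ℤ.+ + 14 ℤ.* x)
  X≡ : + X ≡ x ℤ.* x ℤ.* (x ℤ.* x)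
  X≡ = trans (ℤ.pos-* (∣ x ∣ * ∣ x ∣) (∣ x ∣ * ∣ x ∣)) (cong₂ ℤ._*_ (+∣i∣²≡i² x) (+∣i∣²≡i² x))
  scaled : ∀ c m {i} → + m ≡ i → + (c * m) ≡ + c ℤ.* i
  scaled c m eq = trans (ℤ.pos-* c m) (cong (λ u → + c ℤ.* u) eq)
  collect : ∀ X W V → 32 * (9 * X) + (20 * X + 8 * W + V) ≡ 308 * X + 8 * W + V
  collect = solve-∀
  identity : ∀ x z →
    + 308 ℤ.* (x ℤ.* x ℤ.* (x ℤ.* x))
    ℤ.+ + 8 ℤ.* ((+ 8 ℤ.* (z ℤ.* z) ℤ.+ + 4 ℤ.* (x ℤ.* z) ℤ.+ x ℤ.* x) ℤ.* (+ 8 ℤ.* (z ℤ.* z) ℤ.+ + 4 ℤ.* (x ℤ.* z) ℤ.+ x ℤ.* x))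
    ℤ.+ x ℤ.* (+ 16 ℤ.* z ℤ.+ + 14 ℤ.* x) ℤ.* (x ℤ.* (+ 16 ℤ.* z ℤ.+ + 14 ℤ.* x))
    ≡ + 512 ℤ.* (x ℤ.* x ℤ.* (x ℤ.* x) ℤ.+ x ℤ.* x ℤ.* (x ℤ.* z) ℤ.+ x ℤ.* x ℤ.* (z ℤ.* z)
                 ℤ.+ x ℤ.* z ℤ.* (z ℤ.* z) ℤ.+ z ℤ.* z ℤ.* (z ℤ.* z))
  identity = ℤ-Solver.solve-∀

-- The condition on K says K ≤ (2/√3)^t, exactly the loss that the target allows.
square-bound : ∀ K t M G → M ^ t ≤ K * G → K * K * 3 ^ t ≤ 4 ^ t → 3 ^ t * M ^ (2 * t) ≤ 4 ^ t * G ^ 2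
square-bound K t M G M≤KG K²≤ = begin
  3 ^ t * M ^ (2 * t)           ≡⟨ cong (3 ^ t *_) (m^[2*n]≡m^n*m^n M t) ⟩
  3 ^ t * (M ^ t * M ^ t)       ≤⟨ *-monoʳ-≤ (3 ^ t) (m*m≤ M≤KG) ⟩
  3 ^ t * (K * G * (K * G))     ≡⟨ shuffle (3 ^ t) K G ⟩
  K * K * 3 ^ t * (G * (G * 1)) ≤⟨ *-monoˡ-≤ (G ^ 2) K²≤ ⟩
  4 ^ t * G ^ 2                 ∎
  where
  open ≤-Reasoning
  shuffle : ∀ u K G → u * (K * G * (K * G)) ≡ K * K * u * (G * (G * 1))
  shuffle = solve-∀

-- Odd primes and the factorisation of n

record OddPrime (p : ℕ) : Set where
  constructor oddPrime
  field
    isPrime : Prime p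
    isOdd   : Odd p

≥3 : ∀ {p} → OddPrime p → 3 ≤ p
≥3 (oddPrime pr (zero  , refl)) = contradiction pr ¬prime[1]
≥3 (oddPrime pr (suc j , refl)) = s≤s (s≤s (subst (1 ≤_) (sym (+-suc j j)) (s≤s z≤n)))

even∨odd : ∀ n → (∃ λ j → n ≡ j * 2) ⊎ Odd n
even∨odd zero    = inj₁ (0 , refl)
even∨odd (suc n) with even∨odd n
... | inj₁ (j , n≡) = inj₂ (j , cong suc (trans n≡ (trans (*-comm j 2) (cong (λ i → j + i) (+-identityʳ j)))))
... | inj₂ (j , n≡) = inj₁ (suc j , cong suc (trans n≡ (cong suc (trans (cong (λ i → j + i) (sym (+-identityʳ j))) (*-comm 2 j)))))

prime⇒2∨odd : ∀ {p} → Prime p → p ≡ 2 ⊎ OddPrime p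
prime⇒2∨odd {p} pr with even∨odd p
... | inj₂ odd        = inj₂ (oddPrime pr odd)
... | inj₁ (j , refl) with prime⇒irreducible pr (n∣m*n j)
...   | inj₂ 2≡p = inj₁ (sym 2≡p)

3∨≥5 : ∀ {q} → OddPrime q → q ≡ 3 ⊎ 5 ≤ q
3∨≥5 (oddPrime pr (0 , refl))           = contradiction pr ¬prime[1]
3∨≥5 (oddPrime pr (1 , refl))           = inj₁ refl
3∨≥5 (oddPrime pr (suc (suc j) , refl)) = inj₂ (s≤s (+-mono-≤ (m≤m+n 2 j) (m≤m+n 2 j)))

odd-part : ∀ n .{{_ : NonZero n}} → ∃ λ e → ∃ λ qs → All OddPrime qs × n ≡ product qs * 2 ^ e
odd-part = prime-induction (λ n → ∃ λ e → ∃ λ qs → All OddPrime qs × n ≡ product qs * 2 ^ e) (0 , [] , [] , refl) step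
  where
  shuffle₁ : ∀ P u → P * u * 2 ≡ P * (2 * u)
  shuffle₁ = solve-∀
  shuffle₂ : ∀ P u p → P * u * p ≡ p * P * u
  shuffle₂ = solve-∀
  step : ∀ {p} → Prime p → ∀ m .{{_ : NonZero m}} → (∃ λ e → ∃ λ qs → All OddPrime qs × m ≡ product qs * 2 ^ e) →
         ∃ λ e → ∃ λ qs → All OddPrime qs × m * p ≡ product qs * 2 ^ e
  step {p} pr m (e , qs , os , m≡) with prime⇒2∨odd pr
  ... | inj₁ refl = suc e , qs , os , trans (cong (_* 2) m≡) (shuffle₁ (product qs) (2 ^ e))
  ... | inj₂ op   = e , p ∷ qs , op ∷ os , trans (cong (_* p) m≡) (shuffle₂ (product qs) (2 ^ e) p)


-- Lower bounds

open OddPrime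

∣y^p∣<∣x^p∣ : ∀ {x y} p .{{_ : NonZero p}} → ∣ y ∣ < ∣ x ∣ → ∣ y ℤ.^ p ∣ < ∣ x ℤ.^ p ∣
∣y^p∣<∣x^p∣ {x} {y} p lt = subst₂ _<_ (sym (∣i^n∣≡∣i∣^n y p)) (sym (∣i^n∣≡∣i∣^n x p)) (^-monoˡ-< p lt)

∣x^p∣^t : ∀ x p t → ∣ x ℤ.^ p ∣ ^ t ≡ ∣ x ∣ ^ (p * t)
∣x^p∣^t x p t = trans (cong (_^ t) (∣i^n∣≡∣i∣^n x p)) (^-*-assoc ∣ x ∣ p t)

∣x-y∣≢0 : ∀ {x y} → ∣ y ∣ < ∣ x ∣ → NonZero ∣ x ℤ.- y ∣
∣x-y∣≢0 {x} {y} lt = ≢-nonZero λ eq → <⇒≢ lt (cong ∣_∣ (sym (ℤ.i-j≡0⇒i≡j x y (ℤ.∣i∣≡0⇒i≡0 eq))))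

-- The argument only uses g 1 and the two recursions, which are also satisfied by
-- g n x y = ∣ Φ n y x ∣; this covers the case ∣ x ∣ < ∣ y ∣.
module Estimates (g : ℕ → ℤ → ℤ → ℕ)
  (g-1 : ∀ x y → g 1 x y ≡ ∣ x ℤ.- y ∣)
  (g-∣ : ∀ {p} → Prime p → ∀ {n} → 1 ≤ n → p ∣ n → ∀ {x y} → ∣ y ∣ < ∣ x ∣ →
         g (n * p) x y ≡ g n (x ℤ.^ p) (y ℤ.^ p))
  (g-∤ : ∀ {p} → Prime p → ∀ {n} → 1 ≤ n → ¬ p ∣ n → ∀ {x y} → ∣ y ∣ < ∣ x ∣ →
         g (n * p) x y * g n x y ≡ g n (x ℤ.^ p) (y ℤ.^ p)) where

  LowerBound : ℕ → Set
  LowerBound n = ∀ {x y} → ∣ y ∣ < ∣ x ∣ →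
    3 ^ totient n * ∣ x ∣ ^ (2 * totient n) ≤ 4 ^ totient n * g n x y ^ 2

  -- An upper bound is carried along because the recursion at a new prime divides one value by
  -- another.
  Bounded : ℕ → ℕ → Set
  Bounded n B = ∀ {x y} → ∣ y ∣ < ∣ x ∣ → Within B B (∣ x ∣ ^ totient n) (g n x y)

  StronglyBounded : ℕ → Set
  StronglyBounded n = ∃ λ B → Bounded n B × B * B * 3 ^ totient n ≤ 4 ^ totient n

  strong⇒lower : ∀ {n} → StronglyBounded n → LowerBound n
  strong⇒lower {n} (B , bounded , B²≤) {x} {y} lt =
    square-bound B (totient n) ∣ x ∣ (g n x y) (proj₁ (bounded lt)) B²≤

  -- The bound at (x^p, y^p) already has the full power of |x| and loses only a factor belonging to
  -- the old totient t; the target allows the larger loss belonging to p t.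
  lower-*-∣ : ∀ {p} → Prime p → ∀ {n} → 1 ≤ n → p ∣ n → LowerBound n → LowerBound (n * p)
  lower-*-∣ {p@(suc r)} pr {n} 1≤n p∣n lower {x} {y} lt
    rewrite totient-*-prime-∣ pr 1≤n p∣n | g-∣ pr 1≤n p∣n {x} {y} lt = begin
    3 ^ (p * t) * ∣ x ∣ ^ (2 * (p * t))
      ≡⟨ cong₂ _*_ (^-distribˡ-+-* 3 t (r * t)) (trans (cong (∣ x ∣ ^_) (swap p t)) (sym (∣x^p∣^t x p (2 * t)))) ⟩
    3 ^ t * 3 ^ (r * t) * ∣ x ℤ.^ p ∣ ^ (2 * t)
      ≡⟨ shuffle (3 ^ t) (3 ^ (r * t)) (∣ x ℤ.^ p ∣ ^ (2 * t)) ⟩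
    3 ^ (r * t) * (3 ^ t * ∣ x ℤ.^ p ∣ ^ (2 * t))
      ≤⟨ *-mono-≤ (^-monoˡ-≤ (r * t) (n≤1+n 3)) (lower (∣y^p∣<∣x^p∣ {x} {y} p lt)) ⟩
    4 ^ (r * t) * (4 ^ t * g n (x ℤ.^ p) (y ℤ.^ p) ^ 2)
      ≡⟨ shuffle (4 ^ t) (4 ^ (r * t)) (g n (x ℤ.^ p) (y ℤ.^ p) ^ 2) ⟨
    4 ^ t * 4 ^ (r * t) * g n (x ℤ.^ p) (y ℤ.^ p) ^ 2
      ≡⟨ cong (_* g n (x ℤ.^ p) (y ℤ.^ p) ^ 2) (^-distribˡ-+-* 4 t (r * t)) ⟨
    4 ^ (p * t) * g n (x ℤ.^ p) (y ℤ.^ p) ^ 2 ∎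
    where
    open ≤-Reasoning
    t = totient n
    swap : ∀ p t → 2 * (p * t) ≡ p * (2 * t)
    swap = solve-∀
    shuffle : ∀ u v w → u * v * w ≡ v * (u * w)
    shuffle = solve-∀

  quotient-bounds : ∀ {l u n r} → Prime (suc r) → 1 ≤ n → ¬ suc r ∣ n → ∀ {x y} → ∣ y ∣ < ∣ x ∣ →
    Within l u (∣ x ∣ ^ totient n) (g n x y) →
    Within l u (∣ x ℤ.^ suc r ∣ ^ totient n) (g n (x ℤ.^ suc r) (y ℤ.^ suc r)) →
    Within (l * u) (l * u) (∣ x ∣ ^ totient (n * suc r)) (g (n * suc r) x y)
  quotient-bounds {l} {u} {n} {r} pr 1≤n p∤n {x} {y} lt w W
    rewrite totient-*-prime-∤ pr 1≤n p∤n =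
    quotient-within {l} {u} {{m^n≢0 ∣ x ∣ (totient n) {{>-nonZero (≤-trans (s≤s z≤n) lt)}}}} w
      (subst (λ A → Within l u A (g n (x ℤ.^ suc r) (y ℤ.^ suc r))) split W) (g-∤ pr 1≤n p∤n {x} {y} lt)
    where
    t = totient n
    split : ∣ x ℤ.^ suc r ∣ ^ t ≡ ∣ x ∣ ^ (r * t) * ∣ x ∣ ^ t
    split = trans (∣x^p∣^t x (suc r) t) (trans (cong (∣ x ∣ ^_) (+-comm t (r * t))) (^-distribˡ-+-* ∣ x ∣ (r * t) t))

  -- Oddness of `q` matters: a new prime 2 would square `B` without enlarging the totient, which is
  -- why a factor 2 is put into the base `s` from the start.
  strong-* : ∀ {q} → OddPrime q → ∀ {n} → 1 ≤ n → StronglyBounded n → StronglyBounded (n * q)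
  strong-* {q@(suc r)} oq {n} 1≤n (B , bounded , B²≤) with q ∣? n
  ... | yes q∣n = B , bounded′ , subst (λ i → B * B * 3 ^ i ≤ 4 ^ i) (sym (totient-*-prime-∣ (isPrime oq) 1≤n q∣n))
                        (4^-dominates (B * B) (m≤n*m (totient n) q) B²≤)
    where
    bounded′ : Bounded (n * q) B
    bounded′ {x} {y} lt rewrite g-∣ (isPrime oq) 1≤n q∣n {x} {y} lt | totient-*-prime-∣ (isPrime oq) 1≤n q∣n =
      subst (λ A → Within B B A (g n (x ℤ.^ q) (y ℤ.^ q))) (∣x^p∣^t x q (totient n)) (bounded (∣y^p∣<∣x^p∣ {x} {y} q lt))
  ... | no q∤n  = B * B , (λ {x} {y} lt → quotient-bounds {B} {B} (isPrime oq) 1≤n q∤n {x} {y} lt (bounded lt) (bounded (∣y^p∣<∣x^p∣ {x} {y} q lt)))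
                , subst (λ i → B * B * (B * B) * 3 ^ i ≤ 4 ^ i) (sym (totient-*-prime-∤ (isPrime oq) 1≤n q∤n))
                    (4^-dominates (B * B * (B * B)) (*-monoˡ-≤ t (≤-pred (≥3 oq))) B⁴≤)
    where
    open ≤-Reasoning
    t = totient n
    regroup : ∀ K u → K * K * (u * u) ≡ K * u * (K * u)
    regroup = solve-∀
    B⁴≤ : B * B * (B * B) * 3 ^ (2 * t) ≤ 4 ^ (2 * t)
    B⁴≤ = begin
      B * B * (B * B) * 3 ^ (2 * t)            ≡⟨ cong (B * B * (B * B) *_) (m^[2*n]≡m^n*m^n 3 t) ⟩
      B * B * (B * B) * (3 ^ t * 3 ^ t)        ≡⟨ regroup (B * B) (3 ^ t) ⟩
      B * B * 3 ^ t * (B * B * 3 ^ t)          ≤⟨ m*m≤ B²≤ ⟩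
      4 ^ t * 4 ^ t                            ≡⟨ m^[2*n]≡m^n*m^n 4 t ⟨
      4 ^ (2 * t)                              ∎

  -- The forms g p = (xᵖ - yᵖ) / (x - y) and g (2 p) = (xᵖ + yᵖ) / (x + y), the
  -- second being the first at (x , - y).
  record DifferenceQuotient (s p : ℕ) : Set where
    field
      σ        : ℤ → ℤ
      ∣σ∣      : ∀ y → ∣ σ y ∣ ≡ ∣ y ∣
      σ-^      : ∀ {k} → Odd k → ∀ y → σ (y ℤ.^ k) ≡ σ y ℤ.^ k
      relation : ∀ {x y} → ∣ y ∣ < ∣ x ∣ → g s x y * ∣ x ℤ.- σ y ∣ ≡ ∣ x ℤ.^ p ℤ.- σ y ℤ.^ p ∣
      degree   : totient s ≡ p ∸ 1
      ≥1       : 1 ≤ s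

  quotient-1 : ∀ {p} → OddPrime p → DifferenceQuotient (1 * p) p
  quotient-1 {p@(suc r)} op = record
    { σ = λ y → y ; ∣σ∣ = λ _ → refl ; σ-^ = λ _ _ → refl
    ; relation = λ {x} {y} lt → trans (cong (g (1 * p) x y *_) (sym (g-1 x y)))
                   (trans (g-∤ (isPrime op) ≤-refl p∤1 {x} {y} lt) (g-1 (x ℤ.^ p) (y ℤ.^ p)))
    ; degree = trans (totient-*-prime-∤ (isPrime op) ≤-refl p∤1) (*-identityʳ r)
    ; ≥1 = s≤s z≤n }
    where
    p∤1 : ¬ p ∣ 1
    p∤1 p∣1 = <⇒≱ (≥3 op) (≤-trans (∣⇒≤ p∣1) (s≤s z≤n))

  g-2 : ∀ {x y} → ∣ y ∣ < ∣ x ∣ → g 2 x y ≡ ∣ x ℤ.- (ℤ.- y) ∣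
  g-2 {x} {y} lt = *-cancelʳ-≡ _ _ ∣ x ℤ.- y ∣ {{∣x-y∣≢0 {x} {y} lt}} (begin
    g 2 x y * ∣ x ℤ.- y ∣                ≡⟨ cong (g 2 x y *_) (g-1 x y) ⟨
    g (1 * 2) x y * g 1 x y              ≡⟨ g-∤ prime[2] ≤-refl (λ 2∣1 → <⇒≱ (n<1+n 1) (∣⇒≤ 2∣1)) {x} {y} lt ⟩
    g 1 (x ℤ.^ 2) (y ℤ.^ 2)              ≡⟨ g-1 (x ℤ.^ 2) (y ℤ.^ 2) ⟩
    ∣ x ℤ.^ 2 ℤ.- y ℤ.^ 2 ∣              ≡⟨ cong ∣_∣ (factor x y) ⟩
    ∣ (x ℤ.- (ℤ.- y)) ℤ.* (x ℤ.- y) ∣    ≡⟨ ℤ.abs-* (x ℤ.- (ℤ.- y)) (x ℤ.- y) ⟩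
    ∣ x ℤ.- (ℤ.- y) ∣ * ∣ x ℤ.- y ∣      ∎)
    where
    open ≡-Reasoning
    factor : ∀ x y → x ℤ.* (x ℤ.* 1ℤ) ℤ.+ ℤ.- (y ℤ.* (y ℤ.* 1ℤ)) ≡ (x ℤ.+ ℤ.- (ℤ.- y)) ℤ.* (x ℤ.+ ℤ.- y)
    factor = ℤ-Solver.solve-∀

  quotient-2 : ∀ {p} → OddPrime p → DifferenceQuotient (2 * p) p
  quotient-2 {p@(suc r)} op = record
    { σ = ℤ.-_ ; ∣σ∣ = ℤ.∣-i∣≡∣i∣ ; σ-^ = λ odd y → sym ([-i]^odd odd y)
    ; relation = λ {x} {y} lt → trans (cong (g (2 * p) x y *_) (sym (g-2 {x} {y} lt)))
                   (trans (g-∤ (isPrime op) (s≤s z≤n) p∤2 {x} {y} lt)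
                     (trans (g-2 (∣y^p∣<∣x^p∣ {x} {y} p lt)) (cong (λ v → ∣ x ℤ.^ p ℤ.- v ∣) (sym ([-i]^odd (isOdd op) y)))))
    ; degree = trans (totient-*-prime-∤ (isPrime op) (s≤s z≤n) p∤2) (*-identityʳ r)
    ; ≥1 = s≤s z≤n }
    where
    p∤2 : ¬ p ∣ 2
    p∤2 p∣2 = <⇒≱ (≥3 op) (∣⇒≤ p∣2)

  module _ {s r} (op : OddPrime (suc r)) (dq : DifferenceQuotient s (suc r)) where

    open DifferenceQuotient dq

    private p = suc r

    -- One alternative serves (x, y) and (x^q, y^q) alike, so dividing gives the constant p or 2.
    -- Mixed alternatives could give 2 p, which is too much for p = 3 and q = 5.
    quotient-within-odd : ∀ {x y} → ∣ y ∣ < ∣ x ∣ →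
      (∀ {k} → Odd k → Within 1 p (∣ x ℤ.^ k ∣ ^ r) (g s (x ℤ.^ k) (y ℤ.^ k))) ⊎
      (∀ {k} → Odd k → Within 2 1 (∣ x ℤ.^ k ∣ ^ r) (g s (x ℤ.^ k) (y ℤ.^ k)))
    quotient-within-odd {x} {y} lt = go (odd-power-difference x z z<x)
      where
      open ≡-Reasoning
      z : ℤ
      z = σ y
      G : ℕ → ℕ
      G k = g s (x ℤ.^ k) (y ℤ.^ k)
      z<x : ∣ z ∣ < ∣ x ∣
      z<x = subst (_< ∣ x ∣) (sym (∣σ∣ y)) lt
      z^k<x^k : ∀ {k} → Odd k → ∣ z ∣ ^ k < ∣ x ∣ ^ k
      z^k<x^k (j , refl) = ^-monoˡ-< (suc (j + j)) z<x
      relation-^ : ∀ {k} → Odd k → G k * ∣ x ℤ.^ k ℤ.- z ℤ.^ k ∣ ≡ ∣ x ℤ.^ (k * p) ℤ.- z ℤ.^ (k * p) ∣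
      relation-^ {k} odd@(j , refl) = begin
        G k * ∣ x ℤ.^ k ℤ.- z ℤ.^ k ∣               ≡⟨ cong (λ v → G k * ∣ x ℤ.^ k ℤ.- v ∣) (σ-^ odd y) ⟨
        G k * ∣ x ℤ.^ k ℤ.- σ (y ℤ.^ k) ∣           ≡⟨ relation (∣y^p∣<∣x^p∣ {x} {y} k lt) ⟩
        ∣ (x ℤ.^ k) ℤ.^ p ℤ.- σ (y ℤ.^ k) ℤ.^ p ∣   ≡⟨ cong₂ (λ u v → ∣ u ℤ.- v ∣) (ℤ.^-*-assoc x k p) (trans (cong (ℤ._^ p) (σ-^ odd y)) (ℤ.^-*-assoc z k p)) ⟩
        ∣ x ℤ.^ (k * p) ℤ.- z ℤ.^ (k * p) ∣         ∎
      go : (∀ {k} → Odd k → ∣ x ℤ.^ k ℤ.- z ℤ.^ k ∣ ≡ ∣ x ∣ ^ k ∸ ∣ z ∣ ^ k) ⊎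
           (∀ {k} → Odd k → ∣ x ℤ.^ k ℤ.- z ℤ.^ k ∣ ≡ ∣ x ∣ ^ k + ∣ z ∣ ^ k) →
           (∀ {k} → Odd k → Within 1 p (∣ x ℤ.^ k ∣ ^ r) (G k)) ⊎ (∀ {k} → Odd k → Within 2 1 (∣ x ℤ.^ k ∣ ^ r) (G k))
      go (inj₁ diff) = inj₁ λ {k} odd → subst (λ a → Within 1 p (a ^ r) (G k)) (sym (∣i^n∣≡∣i∣^n x k))
        ([a^p-b^p]/[a-b] r (z^k<x^k odd) (begin
          G k * (∣ x ∣ ^ k ∸ ∣ z ∣ ^ k)           ≡⟨ cong (G k *_) (diff odd) ⟨
          G k * ∣ x ℤ.^ k ℤ.- z ℤ.^ k ∣           ≡⟨ relation-^ odd ⟩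
          ∣ x ℤ.^ (k * p) ℤ.- z ℤ.^ (k * p) ∣     ≡⟨ diff (odd-* odd (isOdd op)) ⟩
          ∣ x ∣ ^ (k * p) ∸ ∣ z ∣ ^ (k * p)       ≡⟨ cong₂ _∸_ (^-*-assoc ∣ x ∣ k p) (^-*-assoc ∣ z ∣ k p) ⟨
          (∣ x ∣ ^ k) ^ p ∸ (∣ z ∣ ^ k) ^ p       ∎))
      go (inj₂ diff) = inj₂ λ {k} odd → subst (λ a → Within 2 1 (a ^ r) (G k)) (sym (∣i^n∣≡∣i∣^n x k))
        ([a^p+b^p]/[a+b] r (z^k<x^k odd) (begin
          G k * (∣ x ∣ ^ k + ∣ z ∣ ^ k)           ≡⟨ cong (G k *_) (diff odd) ⟨
          G k * ∣ x ℤ.^ k ℤ.- z ℤ.^ k ∣           ≡⟨ relation-^ odd ⟩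
          ∣ x ℤ.^ (k * p) ℤ.- z ℤ.^ (k * p) ∣     ≡⟨ diff (odd-* odd (isOdd op)) ⟩
          ∣ x ∣ ^ (k * p) + ∣ z ∣ ^ (k * p)       ≡⟨ cong₂ _+_ (^-*-assoc ∣ x ∣ k p) (^-*-assoc ∣ z ∣ k p) ⟨
          (∣ x ∣ ^ k) ^ p + (∣ z ∣ ^ k) ^ p       ∎))

    at-1 : ∀ {l u x y} → Within l u (∣ x ℤ.^ 1 ∣ ^ r) (g s (x ℤ.^ 1) (y ℤ.^ 1)) → Within l u (∣ x ∣ ^ r) (g s x y)
    at-1 {l} {u} {x} {y} = subst₂ (λ v w → Within l u (∣ v ∣ ^ r) (g s v w)) (ℤ.^-identityʳ x) (ℤ.^-identityʳ y)

    -- In both sign cases B = p will do, as 2 ≤ p. The condition q ≥ 5 makes the totient at least 4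
    -- (p - 1), where p² 3^t ≤ 4^t holds; q = 3 with p = 5 would need the false 25 · 3^8 ≤ 4^8.
    strong-*-quotient : ∀ {q} → OddPrime q → 5 ≤ q → ¬ q ∣ s → StronglyBounded (s * q)
    strong-*-quotient {q@(suc t)} oq 5≤q q∤s = p , bounded , size
      where
      open ≤-Reasoning
      at-degree : ∀ {l u v w} → Within l u (∣ v ∣ ^ r) (g s v w) → Within l u (∣ v ∣ ^ totient s) (g s v w)
      at-degree {l} {u} {v} {w} = subst (λ e → Within l u (∣ v ∣ ^ e) (g s v w)) (sym degree)
      bounded : Bounded (s * q) p
      bounded {x} {y} lt with quotient-within-odd {x} {y} lt
      ... | inj₁ w = within-weaken (≤-reflexive (*-identityˡ p)) (≤-reflexive (*-identityˡ p))
                       (quotient-bounds {1} {p} (isPrime oq) ≥1 q∤s {x} {y} lt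
                         (at-degree {1} {p} {x} {y} (at-1 {1} {p} {x} {y} (w odd-1)))
                         (at-degree {1} {p} {x ℤ.^ q} {y ℤ.^ q} (w (isOdd oq))))
      ... | inj₂ w = within-weaken 2≤p 2≤p
                       (quotient-bounds {2} {1} (isPrime oq) ≥1 q∤s {x} {y} lt
                         (at-degree {2} {1} {x} {y} (at-1 {2} {1} {x} {y} (w odd-1)))
                         (at-degree {2} {1} {x ℤ.^ q} {y ℤ.^ q} (w (isOdd oq))))
        where
        2≤p : 2 ≤ p
        2≤p = <⇒≤ (≥3 op)
      size : p * p * 3 ^ totient (s * q) ≤ 4 ^ totient (s * q)
      size rewrite totient-*-prime-∤ (isPrime oq) ≥1 q∤s | degree =
        4^-dominates (p * p) (*-monoˡ-≤ r (≤-pred 5≤q)) (begin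
          p * p * 3 ^ (4 * r)   ≡⟨ cong (p * p *_) (^-*-assoc 3 4 r) ⟨
          p * p * 81 ^ r        ≤⟨ p²·81^[p-1]≤256^[p-1] p (≥3 op) ⟩
          256 ^ r               ≡⟨ ^-*-assoc 4 4 r ⟩
          4 ^ (4 * r)           ∎)

    -- The constant 2 needs 4 · 3^t ≤ 4^t, first true at t = 5; the totient p - 1 is at least 6
    -- here.
    lower-quotient-≥7 : 7 ≤ p → LowerBound s
    lower-quotient-≥7 7≤p {x} {y} lt rewrite degree with quotient-within-odd {x} {y} lt
    ... | inj₁ w = square-bound 1 r ∣ x ∣ (g s x y) (proj₁ (at-1 {1} {p} {x} {y} (w odd-1)))
                     (4^-dominates 1 {0} {r} z≤n ≤-refl)
    ... | inj₂ w = square-bound 2 r ∣ x ∣ (g s x y) (proj₁ (at-1 {2} {1} {x} {y} (w odd-1)))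
                     (4^-dominates 4 {5} (<⇒≤ (≤-pred 7≤p)) (≤ᵇ⇒≤ (4 * 3 ^ 5) (4 ^ 5) _))

  module _ {s p} (dq : DifferenceQuotient s p) where

    open DifferenceQuotient dq

    quotient-unique : ∀ {x y} F → ∣ y ∣ < ∣ x ∣ → x ℤ.^ p ℤ.- σ y ℤ.^ p ≡ F ℤ.* (x ℤ.- σ y) → g s x y ≡ ∣ F ∣
    quotient-unique {x} {y} F lt eq =
      *-cancelʳ-≡ _ _ ∣ x ℤ.- σ y ∣ {{∣x-y∣≢0 {x} {σ y} (subst (_< ∣ x ∣) (sym (∣σ∣ y)) lt)}}
        (trans (relation {x} {y} lt) (trans (cong ∣_∣ eq) (ℤ.abs-* F (x ℤ.- σ y))))

  lower-quotient-3 : ∀ {s} → DifferenceQuotient s 3 → LowerBound s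
  lower-quotient-3 {s} dq {x} {y} lt =
    subst₂ (λ t G → 3 ^ t * ∣ x ∣ ^ (2 * t) ≤ 4 ^ t * G ^ 2) (sym degree)
      (sym (quotient-unique dq {x} {y} (x ℤ.* x ℤ.+ x ℤ.* σ y ℤ.+ σ y ℤ.* σ y) lt (factor x (σ y)))) (begin
    9 * ∣ x ∣ ^ 4                                    ≡⟨ shuffle₁ ∣ x ∣ ⟩
    3 * (∣ x ∣ * ∣ x ∣) * (3 * (∣ x ∣ * ∣ x ∣))      ≤⟨ m*m≤ (quadratic-bound x (σ y)) ⟩
    4 * F * (4 * F)                                  ≡⟨ shuffle₂ F ⟩
    16 * F ^ 2                                       ∎)
    where
    open DifferenceQuotient dq using (σ; degree)
    open ≤-Reasoning
    F : ℕ
    F = ∣ x ℤ.* x ℤ.+ x ℤ.* σ y ℤ.+ σ y ℤ.* σ y ∣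
    factor : ∀ x z → x ℤ.* (x ℤ.* (x ℤ.* 1ℤ)) ℤ.+ ℤ.- (z ℤ.* (z ℤ.* (z ℤ.* 1ℤ)))
                   ≡ (x ℤ.* x ℤ.+ x ℤ.* z ℤ.+ z ℤ.* z) ℤ.* (x ℤ.+ ℤ.- z)
    factor = ℤ-Solver.solve-∀
    shuffle₁ : ∀ a → 9 * (a * (a * (a * (a * 1)))) ≡ 3 * (a * a) * (3 * (a * a))
    shuffle₁ = solve-∀
    shuffle₂ : ∀ F → 4 * F * (4 * F) ≡ 16 * (F * (F * 1))
    shuffle₂ = solve-∀

  lower-quotient-5 : ∀ {s} → DifferenceQuotient s 5 → LowerBound s
  lower-quotient-5 {s} dq {x} {y} lt =
    subst₂ (λ t G → 3 ^ t * ∣ x ∣ ^ (2 * t) ≤ 4 ^ t * G ^ 2) (sym degree)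
      (sym (quotient-unique dq {x} {y} (quarticForm x (σ y)) lt (factor x (σ y)))) (begin
    81 * ∣ x ∣ ^ 8                          ≡⟨ shuffle₁ ∣ x ∣ ⟩
    9 * X * (9 * X)                         ≤⟨ m*m≤ (quartic-bound x (σ y)) ⟩
    16 * F * (16 * F)                       ≡⟨ shuffle₂ F ⟩
    256 * F ^ 2                             ∎)
    where
    open DifferenceQuotient dq using (σ; degree)
    open ≤-Reasoning
    X F : ℕ
    X = ∣ x ∣ * ∣ x ∣ * (∣ x ∣ * ∣ x ∣)
    F = ∣ quarticForm x (σ y) ∣
    factor : ∀ x z → x ℤ.* (x ℤ.* (x ℤ.* (x ℤ.* (x ℤ.* 1ℤ)))) ℤ.+ ℤ.- (z ℤ.* (z ℤ.* (z ℤ.* (z ℤ.* (z ℤ.* 1ℤ)))))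
                   ≡ (x ℤ.* x ℤ.* (x ℤ.* x) ℤ.+ x ℤ.* x ℤ.* (x ℤ.* z) ℤ.+ x ℤ.* x ℤ.* (z ℤ.* z)
                      ℤ.+ x ℤ.* z ℤ.* (z ℤ.* z) ℤ.+ z ℤ.* z ℤ.* (z ℤ.* z)) ℤ.* (x ℤ.+ ℤ.- z)
    factor = ℤ-Solver.solve-∀
    shuffle₁ : ∀ a → 81 * (a * (a * (a * (a * (a * (a * (a * (a * 1)))))))) ≡ 9 * (a * a * (a * a)) * (9 * (a * a * (a * a)))
    shuffle₁ = solve-∀
    shuffle₂ : ∀ F → 16 * F * (16 * F) ≡ 256 * (F * (F * 1))
    shuffle₂ = solve-∀

  lower-quotient : ∀ {s p} → OddPrime p → DifferenceQuotient s p → LowerBound s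
  lower-quotient (oddPrime pr (0 , refl)) dq = contradiction pr ¬prime[1]
  lower-quotient (oddPrime pr (1 , refl)) dq = lower-quotient-3 dq
  lower-quotient (oddPrime pr (2 , refl)) dq = lower-quotient-5 dq
  lower-quotient op@(oddPrime pr (suc (suc (suc j)) , refl)) dq = lower-quotient-≥7 op dq (s≤s (+-mono-≤ 3≤ 3≤))
    where
    3≤ : 3 ≤ 3 + j
    3≤ = m≤m+n 3 j

  -- Powers of 2 contain no odd prime; they start from Φ_4 = x² + y², obtained from `g-2` at the
  -- squares.
  lower-4 : LowerBound 4
  lower-4 {x} {y} lt = square-bound 1 2 ∣ x ∣ (g 4 x y) (begin
    ∣ x ∣ ^ 2                              ≡⟨ cong (∣ x ∣ *_) (*-identityʳ ∣ x ∣) ⟩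
    ∣ x ∣ * ∣ x ∣                          ≤⟨ m≤m+n _ (∣ y ∣ * ∣ y ∣) ⟩
    ∣ + (∣ x ∣ * ∣ x ∣) ℤ.+ + (∣ y ∣ * ∣ y ∣) ∣  ≡⟨ cong₂ (λ u v → ∣ u ℤ.+ v ∣) (+∣i∣²≡i² x) (+∣i∣²≡i² y) ⟩
    ∣ x ℤ.* x ℤ.+ y ℤ.* y ∣                ≡⟨ cong ∣_∣ (square x y) ⟩
    ∣ x ℤ.^ 2 ℤ.- ℤ.- (y ℤ.^ 2) ∣          ≡⟨ g-2 (∣y^p∣<∣x^p∣ {x} {y} 2 lt) ⟨
    g 2 (x ℤ.^ 2) (y ℤ.^ 2)                ≡⟨ g-∣ prime[2] (s≤s z≤n) ∣-refl {x} {y} lt ⟨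
    g 4 x y                                ≡⟨ *-identityˡ _ ⟨
    1 * g 4 x y                            ∎) (≤ᵇ⇒≤ (3 ^ 2) (4 ^ 2) _)
    where
    open ≤-Reasoning
    square : ∀ x y → x ℤ.* x ℤ.+ y ℤ.* y ≡ x ℤ.* (x ℤ.* 1ℤ) ℤ.+ ℤ.- (ℤ.- (y ℤ.* (y ℤ.* 1ℤ)))
    square = ℤ-Solver.solve-∀

  lower-*-^ : ∀ {p n} → Prime p → 1 ≤ n → p ∣ n → LowerBound n → ∀ e → LowerBound (n * p ^ e)
  lower-*-^ {p} {n} pr 1≤n p∣n lower zero    = subst LowerBound (sym (*-identityʳ n)) lower
  lower-*-^ {p} {n} pr 1≤n p∣n lower (suc e) = subst LowerBound (shuffle n (p ^ e) p)
    (lower-*-∣ pr (≤-trans 1≤n (m≤m*n n (p ^ e) {{m^n≢0 p e {{prime⇒nonZero pr}}}})) (∣m⇒∣m*n (p ^ e) p∣n)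
      (lower-*-^ pr 1≤n p∣n lower e))
    where
    shuffle : ∀ n u p → n * u * p ≡ n * (p * u)
    shuffle = solve-∀

  strong-*-^ : ∀ {p n} → OddPrime p → 1 ≤ n → StronglyBounded n → ∀ e → StronglyBounded (n * p ^ e)
  strong-*-^ {p} {n} op 1≤n strong zero    = subst StronglyBounded (sym (*-identityʳ n)) strong
  strong-*-^ {p} {n} op 1≤n strong (suc e) = subst StronglyBounded (shuffle n (p ^ e) p)
    (strong-* op (≤-trans 1≤n (m≤m*n n (p ^ e) {{m^n≢0 p e {{prime⇒nonZero (isPrime op)}}}})) (strong-*-^ op 1≤n strong e))
    where
    shuffle : ∀ n u p → n * u * p ≡ n * (p * u)
    shuffle = solve-∀

  module OddMultiples (s : ℕ) (1≤s : 1 ≤ s) (s≤2 : s ≤ 2)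
    (quotient-s : ∀ {p} → OddPrime p → DifferenceQuotient (s * p) p) where

    -- With a single odd prime the constant p is in general too large for `StronglyBounded`, so only
    -- the lower bound is kept, together with the factorisation from which a second prime can start.
    Shape : ℕ → Set
    Shape n = n ≡ s
            ⊎ (∃ λ p → ∃ λ j → OddPrime p × n ≡ s * p * p ^ j × LowerBound n)
            ⊎ StronglyBounded n

    odd∤s*p : ∀ {p q} → OddPrime p → OddPrime q → q ≢ p → ¬ q ∣ s * p
    odd∤s*p {p} {q} op oq q≢p q∣sp with euclidsLemma s p (isPrime oq) q∣sp
    ... | inj₁ q∣s = <⇒≱ (≥3 oq) (≤-trans (∣⇒≤ {{>-nonZero 1≤s}} q∣s) s≤2)
    ... | inj₂ q∣p with prime⇒irreducible (isPrime op) q∣p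
    ...   | inj₁ q≡1 = ¬prime[1] (subst Prime q≡1 (isPrime oq))
    ...   | inj₂ q≡p = q≢p q≡p

    strong-pair-≥5 : ∀ {p q} → OddPrime p → OddPrime q → q ≢ p → 5 ≤ q → StronglyBounded (s * p * q)
    strong-pair-≥5 {suc _} op oq q≢p 5≤q = strong-*-quotient op (quotient-s op) oq 5≤q (odd∤s*p op oq q≢p)

    -- The pair is symmetric and at most one of the primes is 3, so a prime that is at least 5 can
    -- be taken as the one added last.
    strong-pair : ∀ {p q} → OddPrime p → OddPrime q → q ≢ p → StronglyBounded (s * p * q)
    strong-pair {p} {q} op oq q≢p with 3∨≥5 oq | 3∨≥5 op
    ... | inj₂ 5≤q  | _         = strong-pair-≥5 op oq q≢p 5≤q
    ... | inj₁ q≡3  | inj₁ p≡3  = contradiction (trans q≡3 (sym p≡3)) q≢p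
    ... | inj₁ _    | inj₂ 5≤p  = subst StronglyBounded (shuffle s q p) (strong-pair-≥5 oq op (λ p≡q → q≢p (sym p≡q)) 5≤p)
      where
      shuffle : ∀ s q p → s * q * p ≡ s * p * q
      shuffle = solve-∀

    1≤s*p : ∀ {p} → OddPrime p → 1 ≤ s * p
    1≤s*p op = *-mono-≤ 1≤s (≤-trans (s≤s z≤n) (≥3 op))

    shape-* : ∀ {n q} → 1 ≤ n → OddPrime q → Shape n → Shape (n * q)
    shape-* {q = q} 1≤n oq (inj₁ refl) =
      inj₂ (inj₁ (q , 0 , oq , sym (*-identityʳ (s * q)) , lower-quotient oq (quotient-s oq)))
    shape-* {n} {q} 1≤n oq (inj₂ (inj₁ (p , j , op , n≡ , lower))) with q ≟ p
    ... | yes refl = inj₂ (inj₁ (q , suc j , oq , trans (cong (_* q) n≡) (shuffle s q (q ^ j))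
                       , lower-*-∣ (isPrime oq) 1≤n (subst (q ∣_) (sym n≡) (∣m⇒∣m*n (q ^ j) (n∣m*n s))) lower))
      where
      shuffle : ∀ s q u → s * q * u * q ≡ s * q * (q * u)
      shuffle = solve-∀
    -- The new prime goes in before the repeated ones: `s * p * q` is bounded first and `p ^ j` is
    -- put back afterwards at no cost to `B`.
    ... | no q≢p   = inj₂ (inj₂ (subst StronglyBounded (trans (shuffle s p q (p ^ j)) (cong (_* q) (sym n≡)))
                       (strong-*-^ op (*-mono-≤ (1≤s*p op) (≤-trans (s≤s z≤n) (≥3 oq))) (strong-pair op oq q≢p) j)))
      where
      shuffle : ∀ s p q u → s * p * q * u ≡ s * p * u * q
      shuffle = solve-∀
    shape-* 1≤n oq (inj₂ (inj₂ strong)) = inj₂ (inj₂ (strong-* oq 1≤n strong))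

    shape : ∀ {qs} → All OddPrime qs → Shape (s * product qs)
    shape []                   = inj₁ (*-identityʳ s)
    shape (_∷_ {q} {qs} oq os) = subst Shape (shuffle s (product qs) q) (shape-* (*-mono-≤ 1≤s (product≥1 os)) oq (shape os))
      where
      product≥1 : ∀ {qs} → All OddPrime qs → 1 ≤ product qs
      product≥1 []        = ≤-refl
      product≥1 (oq ∷ os) = *-mono-≤ (≤-trans (s≤s z≤n) (≥3 oq)) (product≥1 os)
      shuffle : ∀ s P q → s * P * q ≡ s * (q * P)
      shuffle = solve-∀

    lower-shape : ∀ {n} → n ≢ s → Shape n → LowerBound n
    lower-shape n≢s (inj₁ n≡s)                            = contradiction n≡s n≢s
    lower-shape n≢s (inj₂ (inj₁ (_ , _ , _ , _ , lower))) = lower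
    lower-shape n≢s (inj₂ (inj₂ strong))                  = strong⇒lower strong

  lower-bound : ∀ n → 3 ≤ n → LowerBound n
  lower-bound n 3≤n with odd-part n {{>-nonZero (≤-trans (s≤s z≤n) 3≤n)}}
  ... | zero , qs , os , n≡ = subst LowerBound (sym n≡′) (lower-shape (λ eq → <⇒≢ (≤-trans (s≤s (s≤s z≤n)) 3≤n) (sym (trans n≡′ eq))) (shape os))
    where
    open OddMultiples 1 ≤-refl (s≤s z≤n) quotient-1
    shuffle : ∀ P → P * 1 ≡ 1 * P
    shuffle = solve-∀
    n≡′ : n ≡ 1 * product qs
    n≡′ = trans n≡ (shuffle (product qs))
  -- One factor 2 joins the base and the others are added last. The test asks whether n is a power
  -- of 2.
  ... | suc e , qs , os , n≡ = even-case (2 * product qs ≟ 2)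
    where
    open OddMultiples 2 (s≤s z≤n) ≤-refl quotient-2
    shuffle : ∀ P u → P * (2 * u) ≡ 2 * P * u
    shuffle = solve-∀
    n≡′ : n ≡ 2 * product qs * 2 ^ e
    n≡′ = trans n≡ (shuffle (product qs) (2 ^ e))
    power-of-2 : ∀ e → n ≡ 2 * 2 ^ e → LowerBound n
    power-of-2 zero    n≡2 = contradiction (subst (3 ≤_) n≡2 3≤n) λ { (s≤s (s≤s ())) }
    power-of-2 (suc e) n≡  = subst LowerBound (sym (trans n≡ (sym (*-assoc 2 2 (2 ^ e))))) (lower-*-^ prime[2] (s≤s z≤n) (divides 2 refl) lower-4 e)
    even-case : Dec (2 * product qs ≡ 2) → LowerBound n
    even-case (yes eq) = power-of-2 e (trans n≡′ (cong (_* 2 ^ e) eq))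
    even-case (no neq) = subst LowerBound (sym n≡′) (lower-*-^ prime[2]
      (n≢0⇒n>0 λ eq → <⇒≢ (≤-trans (s≤s z≤n) 3≤n) (sym (trans n≡′ (cong (_* 2 ^ e) eq)))) (m∣m*n (product qs)) (lower-shape neq (shape os)) e)

-- The bound for all pairs of integers

module _ {x y} (∣x∣≢∣y∣ : ∣ x ∣ ≢ ∣ y ∣) {p} (pr : Prime p) {n} (1≤n : 1 ≤ n) where

  ∣cycloForm∣-*-∣ : p ∣ n → ∣ cycloForm (n * p) x y ∣ ≡ ∣ cycloForm n (x ℤ.^ p) (y ℤ.^ p) ∣
  ∣cycloForm∣-*-∣ p∣n = cong ∣_∣ (trans (sym (ℤ.*-identityʳ (cycloForm (n * p) x y)))
    (trans (cong (cycloForm (n * p) x y ℤ.*_) (sym (Prods.when-no (¬? (p ∣? n)) (λ p∤n → p∤n p∣n))))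
      (cycloForm-*-prime pr {x} {y} ∣x∣≢∣y∣ n 1≤n)))

  ∣cycloForm∣-*-∤ : ¬ p ∣ n → ∣ cycloForm (n * p) x y ∣ * ∣ cycloForm n x y ∣ ≡ ∣ cycloForm n (x ℤ.^ p) (y ℤ.^ p) ∣
  ∣cycloForm∣-*-∤ p∤n = trans (sym (ℤ.abs-* (cycloForm (n * p) x y) (cycloForm n x y)))
    (cong ∣_∣ (trans (cong (cycloForm (n * p) x y ℤ.*_) (sym (Prods.when-yes (¬? (p ∣? n)) p∤n)))
      (cycloForm-*-prime pr {x} {y} ∣x∣≢∣y∣ n 1≤n)))

module Bound = Estimates (λ n x y → ∣ cycloForm n x y ∣) (λ x y → cong ∣_∣ (cycloForm-1 x y))
  (λ pr 1≤n p∣n {x} {y} lt → ∣cycloForm∣-*-∣ {x} {y} (>⇒≢ lt) pr 1≤n p∣n)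
  (λ pr 1≤n p∤n {x} {y} lt → ∣cycloForm∣-*-∤ {x} {y} (>⇒≢ lt) pr 1≤n p∤n)

module SwappedBound = Estimates (λ n x y → ∣ cycloForm n y x ∣) (λ x y → trans (cong ∣_∣ (cycloForm-1 y x)) (ℤ.∣i-j∣≡∣j-i∣ y x))
  (λ pr 1≤n p∣n {x} {y} lt → ∣cycloForm∣-*-∣ {y} {x} (<⇒≢ lt) pr 1≤n p∣n)
  (λ pr 1≤n p∤n {x} {y} lt → ∣cycloForm∣-*-∤ {y} {x} (<⇒≢ lt) pr 1≤n p∤n)

∣i∣≡∣j∣⇒j≡i*ε : ∀ i j → ∣ i ∣ ≡ ∣ j ∣ → ∃ λ ε → j ≡ i ℤ.* ε
∣i∣≡∣j∣⇒j≡i*ε (+ a)    (+ b)    refl = 1ℤ , sym (ℤ.*-identityʳ (+ a))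
∣i∣≡∣j∣⇒j≡i*ε (+ a)    -[1+ b ] refl = ℤ.-1ℤ , sym (trans (ℤ.*-comm (+ a) ℤ.-1ℤ) (ℤ.-1*i≡-i (+ a)))
∣i∣≡∣j∣⇒j≡i*ε -[1+ a ] (+ b)    refl = ℤ.-1ℤ , sym (trans (ℤ.*-comm -[1+ a ] ℤ.-1ℤ) (ℤ.-1*i≡-i -[1+ a ]))
∣i∣≡∣j∣⇒j≡i*ε -[1+ a ] -[1+ b ] refl = 1ℤ , sym (ℤ.*-identityʳ -[1+ a ])


cycloForm-bound : ∀ n → 3 ≤ n → ∀ x y → cycloForm n x y ≢ 0ℤ →
  3 ^ totient n * (∣ x ∣ ⊔ ∣ y ∣) ^ (2 * totient n) ≤ 4 ^ totient n * ∣ cycloForm n x y ∣ ^ 2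
cycloForm-bound n 3≤n x y F≢0 with <-cmp ∣ x ∣ ∣ y ∣
... | tri< lt _ _ rewrite m≤n⇒m⊔n≡n (<⇒≤ lt) = SwappedBound.lower-bound n 3≤n {y} {x} lt
... | tri> _ _ gt rewrite m≥n⇒m⊔n≡m (<⇒≤ gt) = Bound.lower-bound n 3≤n {x} {y} gt
... | tri≈ _ eq _ rewrite m≥n⇒m⊔n≡m (≤-reflexive (sym eq)) =
  square-bound 1 t ∣ x ∣ ∣ cycloForm n x y ∣
    (≤-trans (m≤m*n (∣ x ∣ ^ t) ∣ c ∣ {{c≢0}}) (≤-reflexive (trans (sym ∣F∣≡) (sym (*-identityˡ _)))))
    (4^-dominates 1 {0} {t} z≤n ≤-refl)
  where
  t = totient n
  ε = proj₁ (∣i∣≡∣j∣⇒j≡i*ε x y eq)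
  c = cycloForm n 1ℤ ε
  -- The pair is (x · 1, x · ε) with ε = ±1, so homogeneity takes out the power of x and leaves an
  -- integer factor.
  F≡ : cycloForm n x y ≡ x ℤ.^ t ℤ.* c
  F≡ = trans (cong₂ (cycloForm n) (sym (ℤ.*-identityʳ x)) (proj₂ (∣i∣≡∣j∣⇒j≡i*ε x y eq)))
         (form-homogeneous (cyclo n) (Monic.length-monic (proj₁ (cyclo-factor n (≤-trans (s≤s z≤n) 3≤n)))) x 1ℤ ε)
  ∣F∣≡ : ∣ cycloForm n x y ∣ ≡ ∣ x ∣ ^ t * ∣ c ∣
  ∣F∣≡ = trans (cong ∣_∣ F≡) (trans (ℤ.abs-* (x ℤ.^ t) c) (cong (_* ∣ c ∣) (∣i^n∣≡∣i∣^n x t)))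
  c≢0 : NonZero ∣ c ∣
  c≢0 = ≢-nonZero λ eq → F≢0 (ℤ.∣i∣≡0⇒i≡0 (trans ∣F∣≡ (trans (cong (∣ x ∣ ^ t *_) eq) (*-zeroʳ (∣ x ∣ ^ t)))))

theorem1p1 : (m n : ℕ) (x y : ℤ) →
    1 ≤ m → 3 ≤ n → 2 ≤ ∣ x ∣ ⊔ ∣ y ∣ → Φ n x y ≡ + m →
    (3 ^ totient n ≤ m ^ 2) ×
    (3 ^ totient n * (∣ x ∣ ⊔ ∣ y ∣) ^ (2 * totient n) ≤ 4 ^ totient n * m ^ 2)
theorem1p1 m n x y 1≤m 3≤n 2≤max Φ≡m = *-cancelˡ-≤ (4 ^ t) {{m^n≢0 4 t}} first , second
  where
  open ≤-Reasoning
  t = totient n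
  F≡m : cycloForm n x y ≡ + m
  F≡m = trans (sym (Φ-cycloForm n (≤-trans (s≤s z≤n) 3≤n) x y)) Φ≡m
  second : 3 ^ t * (∣ x ∣ ⊔ ∣ y ∣) ^ (2 * t) ≤ 4 ^ t * m ^ 2
  second = subst (λ F → 3 ^ t * (∣ x ∣ ⊔ ∣ y ∣) ^ (2 * t) ≤ 4 ^ t * ∣ F ∣ ^ 2) F≡m
    (cycloForm-bound n 3≤n x y (λ F≡0 → >⇒≢ 1≤m (ℤ.+-injective (trans (sym F≡m) F≡0))))
  -- As max ≥ 2, its power 2 t is at least 4^t, which cancels against the 4^t of `second`.
  first : 4 ^ t * 3 ^ t ≤ 4 ^ t * m ^ 2
  first = begin
    4 ^ t * 3 ^ t                          ≡⟨ *-comm (4 ^ t) (3 ^ t) ⟩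
    3 ^ t * 4 ^ t                          ≡⟨ cong (3 ^ t *_) (^-*-assoc 2 2 t) ⟩
    3 ^ t * 2 ^ (2 * t)                    ≤⟨ *-monoʳ-≤ (3 ^ t) (^-monoˡ-≤ (2 * t) 2≤max) ⟩
    3 ^ t * (∣ x ∣ ⊔ ∣ y ∣) ^ (2 * t)      ≤⟨ second ⟩
    4 ^ t * m ^ 2                          ∎
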